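{- Let $G=\mathrm{srg}(n,k,\lambda,\mu)$ be a strongly regular graph with $\mu\ge1$. Then $\mathrm{QEC}(G)\le0$ if and only if $k-2\lambda+\mu\le4$. Moreover, $\mathrm{QEC}(G)=0$ if and only if $k-2\lambda+\mu=4$.
   Context: A graph $G=(V,E)$ is finite and simple. It is strongly regular with parameters $\mathrm{srg}(n,k,\lambda,\mu)$ if $|V|=n$, every vertex has exactly $k$ neighbours, every two adjacent vertices have exactly $\lambda$ common neighbours, and every two distinct non-adjacent vertices have exactly $\mu$ common neighbours. The hypothesis $\mu\ge1$ means in particular that there exist distinct non-adjacent vertices (so $G$ is not complete) and that $G$ is connected. For a connected graph $G=(V,E)$ with $|V|\ge2$, let $D=[d(x,y)]_{x,y\in V}$ be its distance matrix ($d$ the graph distance), and define the quadratic embedding constant \[ \mathrm{QEC}(G)=\max\{\langle f,Df\rangle : f\in\mathbb{R}^V,\ \langle f,f\rangle=1,\ \langle \mathbf{1},f\rangle=0\}, \] where $\mathbf 1$ is the all-ones vector and $\langle\cdot,\cdot\rangle$ the standard inner product. -}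

module Defs where

open import Data.Nat.Base as ℕ using (ℕ; zero; suc)
import Data.Nat.Properties as ℕₚ
open import Data.Integer.Base using (+_)
open import Data.Rational.Base as ℚ using (ℚ; 0ℚ; 1ℚ; ½; ∣_∣)
import Data.Rational.Properties as ℚₚ
open import Data.Rational.Solver using (module +-*-Solver)
open import Data.Fin.Base using (Fin)
import Data.Fin.Properties as Finₚ
open import Data.List.Base using (List; []; _∷_; length; filter; allFin)
open import Data.List.Membership.Propositional using (_∈_)
open import Data.List.Membership.Propositional.Properties using (∈-filter⁻)
open import Data.List.Relation.Unary.Any using (here)
open import Data.Vec.Functional using (Vector; foldr)
open import Data.Product.Base using (∃; _×_; _,_; proj₁; proj₂)
open import Data.Empty using (⊥-elim)
open import Level using (0ℓ)
open import Relation.Nullary using (¬_; yes; no)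
open import Relation.Nullary.Decidable using (_×-dec_; map′)
open import Relation.Unary using (Pred; Decidable)
open import Relation.Binary.Core using (Rel)
import Relation.Binary.Definitions as B
open import Relation.Binary.PropositionalEquality using (_≡_; _≢_; refl; sym; trans; cong; subst)

-- Real numbers: Cauchy sequences of rationals.  The quotient is replaced
-- by the setoid equality _≈ᴿ_ (the difference tends to 0).

IsCauchy : (ℕ → ℚ) → Set
IsCauchy x = ∀ {ε} → 0ℚ ℚ.< ε →
  ∃ λ N → ∀ {m n} → N ℕ.≤ m → N ℕ.≤ n → ∣ x m ℚ.- x n ∣ ℚ.< ε

record ℝ : Set where
  constructor mkℝ
  field
    seq    : ℕ → ℚ
    cauchy : IsCauchy seq

open ℝ public

infix 4 _≈ᴿ_ _≤ᴿ_

_≈ᴿ_ : Rel ℝ 0ℓ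
x ≈ᴿ y = ∀ {ε} → 0ℚ ℚ.< ε →
  ∃ λ N → ∀ {m} → N ℕ.≤ m → ∣ seq x m ℚ.- seq y m ∣ ℚ.< ε

_≤ᴿ_ : Rel ℝ 0ℓ
x ≤ᴿ y = ∀ {ε} → 0ℚ ℚ.< ε →
  ∃ λ N → ∀ {m} → N ℕ.≤ m → seq x m ℚ.< seq y m ℚ.+ ε

fromℚ : ℚ → ℝ
fromℚ q = mkℝ (λ _ → q) λ {ε} 0<ε → 0 , λ _ _ →
  subst (ℚ._< ε) (sym (cong ∣_∣ (ℚₚ.+-inverseʳ q))) 0<ε

fromℕ : ℕ → ℝ
fromℕ n = fromℚ (+ n ℚ./ 1)

0ᴿ 1ᴿ : ℝ
0ᴿ = fromℚ 0ℚ
1ᴿ = fromℚ 1ℚ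

module CauchyLemmas where
  half-pos : ∀ {ε} → 0ℚ ℚ.< ε → 0ℚ ℚ.< ½ ℚ.* ε
  half-pos 0<ε = ℚₚ.*-monoʳ-<-pos ½ 0<ε

  half+half : ∀ ε → ½ ℚ.* ε ℚ.+ ½ ℚ.* ε ≡ ε
  half+half ε = trans (sym (ℚₚ.*-distribʳ-+ ε ½ ½)) (ℚₚ.*-identityˡ ε)

  +-split : ∀ a b c d → (a ℚ.+ b) ℚ.- (c ℚ.+ d) ≡ (a ℚ.- c) ℚ.+ (b ℚ.- d)
  +-split = solve 4 (λ a b c d → (a :+ b) :- (c :+ d) := (a :- c) :+ (b :- d)) refl
    where open +-*-Solver

  *-split : ∀ a b c d → a ℚ.* b ℚ.- c ℚ.* d ≡ a ℚ.* (b ℚ.- d) ℚ.+ d ℚ.* (a ℚ.- c)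
  *-split = solve 4 (λ a b c d → a :* b :- c :* d := a :* (b :- d) :+ d :* (a :- c)) refl
    where open +-*-Solver

  sub-add : ∀ a b → a ≡ (a ℚ.- b) ℚ.+ b
  sub-add = solve 2 (λ a b → a := (a :- b) :+ b) refl
    where open +-*-Solver

  bounded : ∀ {x} → IsCauchy x →
    ∃ λ B → 0ℚ ℚ.< B × ∃ λ N → ∀ {n} → N ℕ.≤ n → ∣ x n ∣ ℚ.≤ B
  bounded {x} cx with cx (ℚₚ.positive⁻¹ 1ℚ)
  ... | N , h = 1ℚ ℚ.+ ∣ x N ∣ ,
    ℚₚ.+-mono-<-≤ (ℚₚ.positive⁻¹ 1ℚ) (ℚₚ.0≤∣p∣ (x N)) , N , λ {n} N≤n → begin
      ∣ x n ∣                      ≡⟨ cong ∣_∣ (sub-add (x n) (x N)) ⟩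
      ∣ (x n ℚ.- x N) ℚ.+ x N ∣    ≤⟨ ℚₚ.∣p+q∣≤∣p∣+∣q∣ (x n ℚ.- x N) (x N) ⟩
      ∣ x n ℚ.- x N ∣ ℚ.+ ∣ x N ∣  ≤⟨ ℚₚ.+-monoˡ-≤ ∣ x N ∣ (ℚₚ.<⇒≤ (h N≤n ℕₚ.≤-refl)) ⟩
      1ℚ ℚ.+ ∣ x N ∣               ∎
    where open ℚₚ.≤-Reasoning

  scale : ∀ {B ε} → 0ℚ ℚ.< B → 0ℚ ℚ.< ε → ∃ λ δ → 0ℚ ℚ.< δ ×
    (∀ {a b} → ∣ a ∣ ℚ.≤ B → ∣ b ∣ ℚ.< δ → ∣ a ℚ.* b ∣ ℚ.< ε)
  scale {B} {ε} 0<B 0<ε = δ , 0<δ , λ {a} {b} a≤B b<δ → begin-strict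
      ∣ a ℚ.* b ∣      ≡⟨ ℚₚ.∣p*q∣≡∣p∣*∣q∣ a b ⟩
      ∣ a ∣ ℚ.* ∣ b ∣  ≤⟨ ℚₚ.*-monoʳ-≤-nonNeg ∣ b ∣ {{ℚ.nonNegative (ℚₚ.0≤∣p∣ b)}} a≤B ⟩
      B ℚ.* ∣ b ∣      <⟨ ℚₚ.*-monoʳ-<-pos B b<δ ⟩
      B ℚ.* δ          ≡⟨ sym (ℚₚ.*-assoc B B⁻¹ ε) ⟩
      B ℚ.* B⁻¹ ℚ.* ε  ≡⟨ cong (ℚ._* ε) (ℚₚ.*-inverseʳ B) ⟩
      1ℚ ℚ.* ε         ≡⟨ ℚₚ.*-identityˡ ε ⟩
      ε                ∎
    where
    open ℚₚ.≤-Reasoning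
    instance
      B-pos : ℚ.Positive B
      B-pos = ℚ.positive 0<B
      B-nonZero : ℚ.NonZero B
      B-nonZero = ℚₚ.pos⇒nonZero B
      B⁻¹-pos : ℚ.Positive (ℚ.1/ B)
      B⁻¹-pos = ℚₚ.1/pos⇒pos B
    B⁻¹ = ℚ.1/ B
    δ = B⁻¹ ℚ.* ε
    0<δ : 0ℚ ℚ.< δ
    0<δ = subst (ℚ._< δ) (ℚₚ.*-zeroʳ B⁻¹) (ℚₚ.*-monoʳ-<-pos B⁻¹ 0<ε)

  halves : ∀ a b {ε} → ∣ a ∣ ℚ.< ½ ℚ.* ε → ∣ b ∣ ℚ.< ½ ℚ.* ε → ∣ a ℚ.+ b ∣ ℚ.< ε
  halves a b {ε} p q = subst (∣ a ℚ.+ b ∣ ℚ.<_) (half+half ε)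
    (ℚₚ.≤-<-trans (ℚₚ.∣p+q∣≤∣p∣+∣q∣ a b) (ℚₚ.+-mono-< p q))

open CauchyLemmas

infixl 6 _+ᴿ_
infixl 7 _*ᴿ_

_+ᴿ_ : ℝ → ℝ → ℝ
mkℝ x cx +ᴿ mkℝ y cy = mkℝ (λ m → x m ℚ.+ y m) λ {ε} 0<ε →
  let N₁ , h₁ = cx (half-pos 0<ε)
      N₂ , h₂ = cy (half-pos 0<ε)
  in N₁ ℕ.⊔ N₂ , λ {m} {n} p q →
    subst (λ t → ∣ t ∣ ℚ.< ε) (sym (+-split (x m) (y m) (x n) (y n)))
      (halves (x m ℚ.- x n) (y m ℚ.- y n)
        (h₁ (ℕₚ.m⊔n≤o⇒m≤o N₁ N₂ p) (ℕₚ.m⊔n≤o⇒m≤o N₁ N₂ q))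
        (h₂ (ℕₚ.m⊔n≤o⇒n≤o N₁ N₂ p) (ℕₚ.m⊔n≤o⇒n≤o N₁ N₂ q)))

_*ᴿ_ : ℝ → ℝ → ℝ
mkℝ x cx *ᴿ mkℝ y cy = mkℝ (λ m → x m ℚ.* y m) λ {ε} 0<ε →
  let Bx , 0<Bx , Mx , bx = bounded cx
      By , 0<By , My , by = bounded cy
      δ₁ , 0<δ₁ , s₁ = scale 0<Bx (half-pos 0<ε)
      δ₂ , 0<δ₂ , s₂ = scale 0<By (half-pos 0<ε)
      N₁ , h₁ = cy 0<δ₁
      N₂ , h₂ = cx 0<δ₂
      M = Mx ℕ.⊔ My
      N = N₁ ℕ.⊔ N₂
  in M ℕ.⊔ N , λ {m} {n} p q →
    let pM = ℕₚ.m⊔n≤o⇒m≤o M N p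
        qM = ℕₚ.m⊔n≤o⇒m≤o M N q
        pN = ℕₚ.m⊔n≤o⇒n≤o M N p
        qN = ℕₚ.m⊔n≤o⇒n≤o M N q
    in subst (λ t → ∣ t ∣ ℚ.< ε) (sym (*-split (x m) (y m) (x n) (y n)))
      (halves (x m ℚ.* (y m ℚ.- y n)) (y n ℚ.* (x m ℚ.- x n))
        (s₁ {x m} {y m ℚ.- y n} (bx (ℕₚ.m⊔n≤o⇒m≤o Mx My pM))
          (h₁ (ℕₚ.m⊔n≤o⇒m≤o N₁ N₂ pN) (ℕₚ.m⊔n≤o⇒m≤o N₁ N₂ qN)))
        (s₂ {y n} {x m ℚ.- x n} (by (ℕₚ.m⊔n≤o⇒n≤o Mx My qM))
          (h₂ (ℕₚ.m⊔n≤o⇒n≤o N₁ N₂ pN) (ℕₚ.m⊔n≤o⇒n≤o N₁ N₂ qN))))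

∑ : ∀ {n} → Vector ℝ n → ℝ
∑ = foldr _+ᴿ_ 0ᴿ

⟨_,_⟩ : ∀ {n} → Vector ℝ n → Vector ℝ n → ℝ
⟨ f , g ⟩ = ∑ λ i → f i *ᴿ g i

𝟏 : ∀ {n} → Vector ℝ n
𝟏 _ = 1ᴿ

Matrix : ℕ → Set
Matrix n = Fin n → Fin n → ℝ

infixr 8 _·_

_·_ : ∀ {n} → Matrix n → Vector ℝ n → Vector ℝ n
(M · f) x = ∑ λ y → M x y *ᴿ f y

record Graph (n : ℕ) : Set₁ where
  infix 4 _~_ _~?_
  field
    _~_      : Rel (Fin n) 0ℓ
    _~?_     : B.Decidable _~_
    ~-sym    : B.Symmetric _~_
    ~-irrefl : ∀ {x} → ¬ (x ~ x)

  neighbours : Fin n → List (Fin n)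
  neighbours x = filter (x ~?_) (allFin n)

  commonNeighbours : Fin n → Fin n → List (Fin n)
  commonNeighbours x y = filter (λ z → (x ~? z) ×-dec (y ~? z)) (allFin n)

  data Walk : Fin n → Fin n → ℕ → Set where
    []  : ∀ {x} → Walk x x 0
    _∷_ : ∀ {x y z m} → x ~ y → Walk y z m → Walk x z (suc m)

  Connected : Set
  Connected = ∀ x y → ∃ λ m → Walk x y m

  NonComplete : Set
  NonComplete = ∃ λ x → ∃ λ y → x ≢ y × ¬ (x ~ y)

  walk? : ∀ x y → Decidable (Walk x y)
  walk? x y zero = map′ (λ { refl → [] }) (λ { [] → refl }) (x Finₚ.≟ y)
  walk? x y (suc m) =
    map′ (λ { (_ , e , w) → e ∷ w }) (λ { (e ∷ w) → _ , e , w })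
      (Finₚ.any? λ z → (x ~? z) ×-dec walk? z y m)

-- srg(n,k,λ,μ), with λ written l.  For a complete graph the last condition is
-- vacuous and μ is arbitrary; μ ≥ 1 is to be read together with NonComplete.
record IsStronglyRegular {n : ℕ} (G : Graph n) (k l μ : ℕ) : Set where
  open Graph G
  field
    degree      : ∀ x → length (neighbours x) ≡ k
    adjacent    : ∀ {x y} → x ~ y → length (commonNeighbours x y) ≡ l
    nonAdjacent : ∀ {x y} → x ≢ y → ¬ (x ~ y) → length (commonNeighbours x y) ≡ μ

least : ∀ {P : Pred ℕ 0ℓ} → Decidable P → ∀ m → P m →
  ∃ λ d → P d × (∀ {j} → P j → d ℕ.≤ j)
least P? zero p = 0 , p , λ _ → ℕ.z≤n
least {P} P? (suc m) p with P? 0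
... | yes p₀ = 0 , p₀ , λ _ → ℕ.z≤n
... | no ¬p₀ with least (λ j → P? (suc j)) m p
...   | d , pd , d-least = suc d , pd , λ {j} → minimal j
  where
  minimal : ∀ j → P j → suc d ℕ.≤ j
  minimal zero    q = ⊥-elim (¬p₀ q)
  minimal (suc j) q = ℕ.s≤s (d-least q)

module _ {n : ℕ} (G : Graph n) (conn : Graph.Connected G) where
  open Graph G

  dist : Fin n → Fin n → ℕ
  dist x y = proj₁ (least (walk? x y) (proj₁ (conn x y)) (proj₂ (conn x y)))

  distanceMatrix : Matrix n
  distanceMatrix x y = fromℕ (dist x y)

  Admissible : Vector ℝ n → Set
  Admissible f = ⟨ f , f ⟩ ≈ᴿ 1ᴿ × ⟨ 𝟏 , f ⟩ ≈ᴿ 0ᴿ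

  -- q is the maximum (attained, hence unique up to _≈ᴿ_) defining QEC(G).
  IsQEC : ℝ → Set
  IsQEC q =
    (∃ λ f → Admissible f × ⟨ f , distanceMatrix · f ⟩ ≈ᴿ q) ×
    (∀ f → Admissible f → ⟨ f , distanceMatrix · f ⟩ ≤ᴿ q)

module _ {n : ℕ} {G : Graph n} {k l μ : ℕ} where
  open Graph G

  srg-connected : IsStronglyRegular G k l μ → 1 ℕ.≤ μ → Connected
  srg-connected srg 1≤μ x y with x Finₚ.≟ y
  ... | yes refl = 0 , []
  ... | no x≢y with x ~? y
  ...   | yes x~y = 1 , x~y ∷ []
  ...   | no x≁y = via (commonNeighbours x y) refl
            (subst (1 ℕ.≤_) (sym (IsStronglyRegular.nonAdjacent srg x≢y x≁y)) 1≤μ)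
    where
    via : ∀ zs → commonNeighbours x y ≡ zs → 1 ℕ.≤ length (commonNeighbours x y) →
          ∃ λ m → Walk x y m
    via [] eq 1≤len with subst (λ zs → 1 ℕ.≤ length zs) eq 1≤len
    ... | ()
    via (z ∷ zs) eq _ with ∈-filter⁻ (λ z → (x ~? z) ×-dec (y ~? z)) {xs = allFin n}
                           (subst (z ∈_) (sym eq) (here refl))
    ... | _ , x~z , y~z = 2 , x~z ∷ ~-sym y~z ∷ []

{-# OPTIONS --safe #-}

-- Since μ ≥ 1 and G is not complete, G has diameter 2 and D = 2J - 2I - A.  With
-- a = λ - μ and b = k - μ one has A² = a A + b I + μ J, so on the complement of 𝟏
-- the eigenvalues of A are the roots r > s of X² - a X - b, and ⟨f,Df⟩ = -2 - ⟨f,Af⟩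
-- for unit f.  There ‖(A - s)f‖² = (r - s)(⟨f,Af⟩ - s) bounds ⟨f,Df⟩ by q = -2 - s,
-- and for an edge x ~ y the vector (A - r)(e_x - e_y) is nonzero, because its entry
-- at x is -(1 + r), and attains the bound.  Finally, with σ = r - s,
-- q (σ + 4 + a) = -2 (4 - (k - 2λ + μ)).
--
-- Reals are sequences, so all of this is done termwise in ℚ: with rational
-- approximations of σ the identities hold exactly up to multiples of E = b + r s,
-- ⟨f,f⟩ - 1 and ⟨𝟏,f⟩, which are null sequences.
module Submission where

open import Defs
open import Algebra.Bundles using (CommutativeRing)
import Algebra.Properties.Semiring.Sum as Sum
open import Data.Bool.Base using (if_then_else_)
open import Data.Empty using (⊥-elim)
open import Data.Fin.Base using (Fin; zero; suc)
import Data.Fin.Properties as Finₚ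
import Data.Integer.Base as ℤ
import Data.Integer.Properties as ℤₚ
open import Data.List.Base using (_∷_; length; filter; allFin; tabulate)
open import Data.Nat.Base as ℕ using (ℕ; zero; suc)
import Data.Nat.Properties as ℕₚ
open import Data.Product.Base using (∃; _×_; _,_; proj₁; proj₂)
import Data.Rational.Base as ℚ
import Data.Rational.Properties as ℚₚ
import Data.Rational.Solver as ℚSolver
import Data.Rational.Unnormalised.Base as ℚᵘ
import Data.Rational.Unnormalised.Properties as ℚᵘₚ
open import Data.Sum.Base using (inj₁; inj₂; [_,_]′)
open import Data.Vec.Functional using (Vector)
open import Function.Bundles using (_⇔_; mk⇔)
open import Level using (0ℓ)
open import Relation.Binary.PropositionalEquality using (_≡_; _≢_; refl; sym; trans; cong; cong₂; subst; module ≡-Reasoning)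
open import Relation.Nullary using (¬_; Dec; does; yes; no)
open import Relation.Nullary.Decidable using (_×-dec_)
open import Relation.Unary using (Pred; Decidable)

-- Rational arithmetic: integers in `ℚ`, order, squares and reciprocals.

module RationalLemmas where
  open ℚ using (ℚ; 0ℚ; 1ℚ; _+_; _*_; _-_; -_; _≤_; _<_; ∣_∣)
  open ℚSolver.+-*-Solver

  ι : ℤ.ℤ → ℚ
  ι i = i ℚ./ 1

  -- Normalisation divides by a gcd and blocks computation. On unnormalised rationals the arithmetic
  -- of `ι` reduces to that of integers.
  toℚᵘ-ι : ∀ i → ℚ.toℚᵘ (ι i) ℚᵘ.≃ ℚᵘ.mkℚᵘ i 0
  toℚᵘ-ι i = ℚₚ.toℚᵘ-fromℚᵘ (ℚᵘ.mkℚᵘ i 0)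

  ι-+ : ∀ i j → ι (i ℤ.+ j) ≡ ι i + ι j
  ι-+ i j = ℚₚ.toℚᵘ-injective (begin
    ℚ.toℚᵘ (ι (i ℤ.+ j))                 ≈⟨ toℚᵘ-ι (i ℤ.+ j) ⟩
    ℚᵘ.mkℚᵘ (i ℤ.+ j) 0                  ≡⟨ cong (λ t → ℚᵘ.mkℚᵘ t 0) (cong₂ ℤ._+_ (ℤₚ.*-identityʳ i) (ℤₚ.*-identityʳ j)) ⟨
    ℚᵘ.mkℚᵘ i 0 ℚᵘ.+ ℚᵘ.mkℚᵘ j 0         ≈⟨ ℚᵘₚ.+-cong (toℚᵘ-ι i) (toℚᵘ-ι j) ⟨
    ℚ.toℚᵘ (ι i) ℚᵘ.+ ℚ.toℚᵘ (ι j)       ≈⟨ ℚₚ.toℚᵘ-homo-+ (ι i) (ι j) ⟨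
    ℚ.toℚᵘ (ι i + ι j)                   ∎)
    where open ℚᵘₚ.≃-Reasoning

  ι-* : ∀ i j → ι (i ℤ.* j) ≡ ι i * ι j
  ι-* i j = ℚₚ.toℚᵘ-injective (begin
    ℚ.toℚᵘ (ι (i ℤ.* j))                 ≈⟨ toℚᵘ-ι (i ℤ.* j) ⟩
    ℚᵘ.mkℚᵘ i 0 ℚᵘ.* ℚᵘ.mkℚᵘ j 0         ≈⟨ ℚᵘₚ.*-cong (toℚᵘ-ι i) (toℚᵘ-ι j) ⟨
    ℚ.toℚᵘ (ι i) ℚᵘ.* ℚ.toℚᵘ (ι j)       ≈⟨ ℚₚ.toℚᵘ-homo-* (ι i) (ι j) ⟨
    ℚ.toℚᵘ (ι i * ι j)                   ∎)
    where open ℚᵘₚ.≃-Reasoning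

  ι-neg : ∀ i → ι (ℤ.- i) ≡ - ι i
  ι-neg i = begin
    ι (ℤ.- i)               ≡⟨ cong ι (ℤₚ.-1*i≡-i i) ⟨
    ι (ℤ.-1ℤ ℤ.* i)         ≡⟨ ι-* ℤ.-1ℤ i ⟩
    ι ℤ.-1ℤ * ι i           ≡⟨ solve 1 (λ x → con (ι ℤ.-1ℤ) :* x := :- x) refl (ι i) ⟩
    - ι i                   ∎
    where open ≡-Reasoning

  ι-mono-≤ : ∀ {i j} → i ℤ.≤ j → ι i ≤ ι j
  ι-mono-≤ {i} {j} i≤j = ℚₚ.toℚᵘ-cancel-≤ (begin
    ℚ.toℚᵘ (ι i)   ≃⟨ toℚᵘ-ι i ⟩
    ℚᵘ.mkℚᵘ i 0    ≤⟨ ℚᵘ.*≤* (ℤₚ.*-monoʳ-≤-nonNeg ℤ.1ℤ i≤j) ⟩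
    ℚᵘ.mkℚᵘ j 0    ≃⟨ toℚᵘ-ι j ⟨
    ℚ.toℚᵘ (ι j)   ∎)
    where open ℚᵘₚ.≤-Reasoning

  ι-cancel-≤ : ∀ {i j} → ι i ≤ ι j → i ℤ.≤ j
  ι-cancel-≤ {i} {j} p = ℤₚ.*-cancelʳ-≤-pos i j ℤ.1ℤ (ℚᵘₚ.drop-*≤* (begin
    ℚᵘ.mkℚᵘ i 0    ≃⟨ toℚᵘ-ι i ⟨
    ℚ.toℚᵘ (ι i)   ≤⟨ ℚₚ.toℚᵘ-mono-≤ p ⟩
    ℚ.toℚᵘ (ι j)   ≃⟨ toℚᵘ-ι j ⟩
    ℚᵘ.mkℚᵘ j 0    ∎))
    where open ℚᵘₚ.≤-Reasoning

  ≤-from-diff : ∀ {p q} d → 0ℚ ≤ d → q ≡ p + d → p ≤ q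
  ≤-from-diff {p} d 0≤d eq = begin
    p        ≡⟨ ℚₚ.+-identityʳ p ⟨
    p + 0ℚ   ≤⟨ ℚₚ.+-monoʳ-≤ p 0≤d ⟩
    p + d    ≡⟨ eq ⟨
    _        ∎
    where open ℚₚ.≤-Reasoning

  ≤⇒0≤- : ∀ {p q} → p ≤ q → 0ℚ ≤ q - p
  ≤⇒0≤- {p} {q} p≤q = subst (_≤ q - p) (ℚₚ.+-inverseʳ p) (ℚₚ.+-monoˡ-≤ (- p) p≤q)

  +-nonNeg : ∀ {p q} → 0ℚ ≤ p → 0ℚ ≤ q → 0ℚ ≤ p + q
  +-nonNeg = ℚₚ.+-mono-≤

  *-nonNeg : ∀ {p q} → 0ℚ ≤ p → 0ℚ ≤ q → 0ℚ ≤ p * q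
  *-nonNeg {p} {q} 0≤p 0≤q = subst (_≤ p * q) (ℚₚ.*-zeroˡ q)
    (ℚₚ.*-monoʳ-≤-nonNeg q {{ℚ.nonNegative 0≤q}} 0≤p)

  *-pos : ∀ {p q} → 0ℚ < p → 0ℚ < q → 0ℚ < p * q
  *-pos {p} {q} 0<p 0<q = ℚₚ.positive⁻¹ (p * q) {{ℚₚ.pos*pos⇒pos p {{ℚ.positive 0<p}} q {{ℚ.positive 0<q}}}}

  square-nonNeg : ∀ p → 0ℚ ≤ p * p
  square-nonNeg p with ℚₚ.≤-total 0ℚ p
  ... | inj₁ 0≤p = *-nonNeg 0≤p 0≤p
  ... | inj₂ p≤0 = subst (0ℚ ≤_) (solve 1 (λ x → (:- x) :* (:- x) := x :* x) refl p)
    (*-nonNeg (ℚₚ.neg-antimono-≤ p≤0) (ℚₚ.neg-antimono-≤ p≤0))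

  square-mono-≤ : ∀ {p q} → 0ℚ ≤ p → p ≤ q → p * p ≤ q * q
  square-mono-≤ {p} {q} 0≤p p≤q = ≤-from-diff ((q - p) * (p + q))
    (*-nonNeg (≤⇒0≤- p≤q) (+-nonNeg 0≤p (ℚₚ.≤-trans 0≤p p≤q)))
    (solve 2 (λ x y → y :* y := x :* x :+ (y :- x) :* (x :+ y)) refl p q)

  square-cancel-< : ∀ {p q} → 0ℚ ≤ q → p * p < q * q → p < q
  square-cancel-< {p} {q} 0≤q pp<qq with p ℚₚ.<? q
  ... | yes p<q = p<q
  ... | no p≮q  = ⊥-elim (ℚₚ.<-irrefl refl (ℚₚ.<-≤-trans pp<qq (square-mono-≤ 0≤q (ℚₚ.≮⇒≥ p≮q))))

  square-cancel-≤ : ∀ {p q} → 0ℚ ≤ q → p * p ≤ q * q → p ≤ q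
  square-cancel-≤ {p} {q} 0≤q pp≤qq with p ℚₚ.≤? q
  ... | yes p≤q = p≤q
  ... | no p≰q  = ⊥-elim (ℚₚ.<-irrefl refl (ℚₚ.≤-<-trans pp≤qq (begin-strict
    q * q  ≤⟨ ℚₚ.*-monoˡ-≤-nonNeg q {{ℚ.nonNegative 0≤q}} (ℚₚ.<⇒≤ q<p) ⟩
    q * p  <⟨ ℚₚ.*-monoˡ-<-pos p {{ℚ.positive (ℚₚ.≤-<-trans 0≤q q<p)}} q<p ⟩
    p * p  ∎)))
    where
    open ℚₚ.≤-Reasoning
    q<p = ℚₚ.≰⇒> p≰q

  p≤∣p∣ : ∀ p → p ≤ ∣ p ∣
  p≤∣p∣ p with ℚₚ.≤-total 0ℚ p
  ... | inj₁ 0≤p = ℚₚ.≤-reflexive (sym (ℚₚ.0≤p⇒∣p∣≡p 0≤p))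
  ... | inj₂ p≤0 = ℚₚ.≤-trans p≤0 (ℚₚ.0≤∣p∣ p)

  ∣∣≤ : ∀ {p q} → p ≤ q → - p ≤ q → ∣ p ∣ ≤ q
  ∣∣≤ {p} p≤q -p≤q with ℚₚ.∣p∣≡p∨∣p∣≡-p p
  ... | inj₁ eq = subst (_≤ _) (sym eq) p≤q
  ... | inj₂ eq = subst (_≤ _) (sym eq) -p≤q

  0<1 : 0ℚ < 1ℚ
  0<1 = ℚₚ.positive⁻¹ 1ℚ

  -- The reciprocal, with the junk value 0 at 0.
  inv : ℚ → ℚ
  inv p with p ℚₚ.≟ 0ℚ
  ... | yes _  = 0ℚ
  ... | no p≢0 = (ℚ.1/ p) {{ℚ.≢-nonZero p≢0}}

  *-inv : ∀ {p} → 0ℚ < p → p * inv p ≡ 1ℚ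
  *-inv {p} 0<p with p ℚₚ.≟ 0ℚ
  ... | yes refl = ⊥-elim (ℚₚ.<-irrefl refl 0<p)
  ... | no p≢0   = ℚₚ.*-inverseʳ p {{ℚ.≢-nonZero p≢0}}

  inv-pos : ∀ {p} → 0ℚ < p → 0ℚ < inv p
  inv-pos {p} 0<p with inv p ℚₚ.≤? 0ℚ
  ... | no inv≰0  = ℚₚ.≰⇒> inv≰0
  ... | yes inv≤0 = ⊥-elim (ℚₚ.<-irrefl refl (begin-strict
    0ℚ          <⟨ 0<1 ⟩
    1ℚ          ≡⟨ *-inv 0<p ⟨
    p * inv p   ≤⟨ ℚₚ.*-monoˡ-≤-nonNeg p {{ℚ.nonNegative (ℚₚ.<⇒≤ 0<p)}} inv≤0 ⟩
    p * 0ℚ      ≡⟨ ℚₚ.*-zeroʳ p ⟩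
    0ℚ          ∎))
    where open ℚₚ.≤-Reasoning

  -- The denominator is at least 1, so dropping it and taking the absolute value of the numerator
  -- can only increase `p`.
  ≤-ι∣↥∣ : ∀ p → p ≤ ι (ℤ.+ ℤ.∣ ℚ.↥ p ∣)
  ≤-ι∣↥∣ p@(ℚ.mkℚ i d-1 _) = ℚₚ.toℚᵘ-cancel-≤ (begin
    ℚ.toℚᵘ p                        ≤⟨ ℚᵘ.*≤* lem ⟩
    ℚᵘ.mkℚᵘ (ℤ.+ ℤ.∣ i ∣) 0         ≃⟨ toℚᵘ-ι (ℤ.+ ℤ.∣ i ∣) ⟨
    ℚ.toℚᵘ (ι (ℤ.+ ℤ.∣ i ∣))        ∎)
    where
    open ℚᵘₚ.≤-Reasoning
    lem : i ℤ.* ℤ.1ℤ ℤ.≤ ℤ.+ ℤ.∣ i ∣ ℤ.* ℤ.+ suc d-1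
    lem = ℤₚ.≤-trans (ℤₚ.≤-reflexive (ℤₚ.*-identityʳ i)) (ℤₚ.≤-trans (i≤ i)
      (ℤₚ.≤-trans (ℤ.+≤+ (ℕₚ.m≤m*n ℤ.∣ i ∣ (suc d-1))) (ℤₚ.≤-reflexive (ℤₚ.pos-* ℤ.∣ i ∣ (suc d-1)))))
      where
      i≤ : ∀ i → i ℤ.≤ ℤ.+ ℤ.∣ i ∣
      i≤ (ℤ.+ n)      = ℤₚ.≤-refl
      i≤ (ℤ.-[1+ n ]) = ℤ.-≤+

  -- The witness bounds `C / ε`, being the absolute value of its numerator.
  archimedean : ∀ C {ε} → 0ℚ < ε → ∃ λ n → C ≤ ι (ℤ.+ n) * ε
  archimedean C {ε} 0<ε = ℤ.∣ ℚ.↥ (C * inv ε) ∣ , (begin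
    C                   ≡⟨ ℚₚ.*-identityʳ C ⟨
    C * 1ℚ              ≡⟨ cong (C *_) (*-inv 0<ε) ⟨
    C * (ε * inv ε)     ≡⟨ solve 3 (λ x y z → x :* (y :* z) := (x :* z) :* y) refl C ε (inv ε) ⟩
    (C * inv ε) * ε     ≤⟨ ℚₚ.*-monoʳ-≤-nonNeg ε {{ℚ.nonNegative (ℚₚ.<⇒≤ 0<ε)}} (≤-ι∣↥∣ (C * inv ε)) ⟩
    ι (ℤ.+ ℤ.∣ ℚ.↥ (C * inv ε) ∣) * ε  ∎)
    where open ℚₚ.≤-Reasoning

  0≤ι : ∀ n → 0ℚ ≤ ι (ℤ.+ n)
  0≤ι n = ι-mono-≤ {ℤ.0ℤ} {ℤ.+ n} (ℤ.+≤+ ℕ.z≤n)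

  ι-suc : ∀ n → ι (ℤ.+ suc n) ≡ 1ℚ + ι (ℤ.+ n)
  ι-suc n = ι-+ ℤ.1ℤ (ℤ.+ n)

  0<ιsuc : ∀ n → 0ℚ < ι (ℤ.+ suc n)
  0<ιsuc n = subst (0ℚ <_) (sym (ι-suc n)) (ℚₚ.+-mono-<-≤ 0<1 (0≤ι n))

  ι<ιsuc : ∀ n → ι (ℤ.+ n) < ι (ℤ.+ suc n)
  ι<ιsuc n = subst (_< ι (ℤ.+ suc n)) (ℚₚ.+-identityˡ (ι (ℤ.+ n)))
    (subst (0ℚ + ι (ℤ.+ n) <_) (sym (ι-suc n)) (ℚₚ.+-monoˡ-< (ι (ℤ.+ n)) 0<1))

-- Null sequences and limits of rational sequences.

module RealLemmas where
  open ℚ using (ℚ; 0ℚ; 1ℚ; ½; _+_; _*_; _-_; -_; _≤_; _<_; ∣_∣)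
  open ℚSolver.+-*-Solver
  open RationalLemmas
  open CauchyLemmas

  -- x ≈ᴿ y unfolds to Null (λ m → seq x m - seq y m).
  Null : (ℕ → ℚ) → Set
  Null u = ∀ {ε} → 0ℚ < ε → ∃ λ N → ∀ {m} → N ℕ.≤ m → ∣ u m ∣ < ε

  null-dominated : ∀ {u v} → (∀ m → ∣ u m ∣ ≤ ∣ v m ∣) → Null v → Null u
  null-dominated u≤v nv 0<ε with nv 0<ε
  ... | N , h = N , λ {m} N≤m → ℚₚ.≤-<-trans (u≤v m) (h N≤m)

  null-resp : ∀ {u v} → (∀ m → u m ≡ v m) → Null v → Null u
  null-resp {u} {v} u≡v = null-dominated λ m → ℚₚ.≤-reflexive (cong ∣_∣ (u≡v m))

  null-0 : Null (λ _ → 0ℚ)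
  null-0 0<ε = 0 , λ _ → 0<ε

  null-+ : ∀ {u v} → Null u → Null v → Null (λ m → u m + v m)
  null-+ {u} {v} nu nv 0<ε with nu (half-pos 0<ε) | nv (half-pos 0<ε)
  ... | M , f | N , g = M ℕ.⊔ N , λ {m} p → halves (u m) (v m)
    (f (ℕₚ.m⊔n≤o⇒m≤o M N p)) (g (ℕₚ.m⊔n≤o⇒n≤o M N p))

  null-* : ∀ (x : ℝ) {u} → Null u → Null (λ m → seq x m * u m)
  null-* x {u} nu 0<ε =
    let B , 0<B , M , bx = bounded (cauchy x)
        δ , 0<δ , s = scale 0<B 0<ε
        N , h = nu 0<δ
    in M ℕ.⊔ N , λ {m} p → s {seq x m} {u m} (bx (ℕₚ.m⊔n≤o⇒m≤o M N p)) (h (ℕₚ.m⊔n≤o⇒n≤o M N p))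

  null-+⁻ : ∀ {u v} → Null (λ m → u m + v m) → Null v → Null u
  null-+⁻ {u} {v} nuv nv = null-resp
    (λ m → solve 2 (λ x y → x := (x :+ y) :+ con (- 1ℚ) :* y) refl (u m) (v m))
    (null-+ nuv (null-* (fromℚ (- 1ℚ)) nv))

  null-const : ∀ {p} → Null (λ _ → p) → p ≡ 0ℚ
  null-const {p} np with p ℚₚ.≟ 0ℚ
  ... | yes p≡0 = p≡0
  -- Taking `ε = ∣ p ∣` gives `∣ p ∣ < ∣ p ∣`.
  ... | no p≢0  = ⊥-elim (ℚₚ.<-irrefl refl (proj₂ (np 0<∣p∣) ℕₚ.≤-refl))
    where
    0<∣p∣ : 0ℚ < ∣ p ∣
    0<∣p∣ = ℚₚ.≰⇒> λ ∣p∣≤0 → p≢0 (ℚₚ.∣p∣≡0⇒p≡0 p (ℚₚ.≤-antisym ∣p∣≤0 (ℚₚ.0≤∣p∣ p)))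

  null-cancel : ∀ {u v : ℕ → ℚ} → (∀ m → 1ℚ ≤ v m) → Null (λ m → u m * v m) → Null u
  null-cancel {u} {v} 1≤v = null-dominated λ m → begin
    ∣ u m ∣              ≡⟨ ℚₚ.*-identityʳ ∣ u m ∣ ⟨
    ∣ u m ∣ * 1ℚ         ≤⟨ ℚₚ.*-monoˡ-≤-nonNeg ∣ u m ∣ {{ℚₚ.∣-∣-nonNeg (u m)}} (ℚₚ.≤-trans (1≤v m) (p≤∣p∣ (v m))) ⟩
    ∣ u m ∣ * ∣ v m ∣    ≡⟨ ℚₚ.∣p*q∣≡∣p∣*∣q∣ (u m) (v m) ⟨
    ∣ u m * v m ∣        ∎
    where open ℚₚ.≤-Reasoning

  -- x ≤ᴿ 0ᴿ unfolds to this up to adding 0ℚ.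
  LimNonPos : (ℕ → ℚ) → Set
  LimNonPos u = ∀ {ε} → 0ℚ < ε → ∃ λ N → ∀ {m} → N ℕ.≤ m → u m < ε

  null⇒limNonPos : ∀ {u} → Null u → LimNonPos u
  null⇒limNonPos {u} nu 0<ε with nu 0<ε
  ... | N , h = N , λ {m} p → ℚₚ.≤-<-trans (p≤∣p∣ (u m)) (h p)

  limNonPos-dominated : ∀ {u v} → (∀ m → u m ≤ v m) → LimNonPos v → LimNonPos u
  limNonPos-dominated u≤v lv 0<ε with lv 0<ε
  ... | N , h = N , λ {m} p → ℚₚ.≤-<-trans (u≤v m) (h p)

  -- Only indices with `u m` nonnegative matter, and there multiplication by `v m` can only increase
  -- the term.
  limNonPos-cancel : ∀ {u v : ℕ → ℚ} → (∀ m → 1ℚ ≤ v m) → LimNonPos (λ m → u m * v m) → LimNonPos u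
  limNonPos-cancel {u} {v} 1≤v luv {ε} 0<ε with luv 0<ε
  ... | N , h = N , λ {m} p → lem m (h p)
    where
    open ℚₚ.≤-Reasoning
    lem : ∀ m → u m * v m < ε → u m < ε
    lem m uv<ε with ℚₚ.≤-total 0ℚ (u m)
    ... | inj₂ u≤0 = ℚₚ.≤-<-trans u≤0 0<ε
    ... | inj₁ 0≤u = begin-strict
      u m          ≡⟨ ℚₚ.*-identityʳ (u m) ⟨
      u m * 1ℚ     ≤⟨ ℚₚ.*-monoˡ-≤-nonNeg (u m) {{ℚ.nonNegative 0≤u}} (1≤v m) ⟩
      u m * v m    <⟨ uv<ε ⟩
      ε            ∎

  -- A nonnegative factor leaves nonpositive terms below `ε`. On the other terms it is at most a
  -- bound `B` of `x`, so it is enough that `u` falls below `ε / B`.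
  limNonPos-* : ∀ {u} (x : ℝ) → (∀ m → 0ℚ ≤ seq x m) → LimNonPos u → LimNonPos (λ m → u m * seq x m)
  limNonPos-* {u} x 0≤x lu {ε} 0<ε =
    let B , 0<B , M , bx = bounded (cauchy x)
        N , h = lu (*-pos 0<ε (inv-pos 0<B))
    in M ℕ.⊔ N , λ {m} p → lem m 0<B (bx (ℕₚ.m⊔n≤o⇒m≤o M N p)) (h (ℕₚ.m⊔n≤o⇒n≤o M N p))
    where
    open ℚₚ.≤-Reasoning
    lem : ∀ m {B} → 0ℚ < B → ∣ seq x m ∣ ≤ B → u m < ε * inv B → u m * seq x m < ε
    lem m {B} 0<B x≤B u<ε/B with ℚₚ.≤-total 0ℚ (u m)
    ... | inj₁ 0≤u = begin-strict
      u m * seq x m     ≤⟨ ℚₚ.*-monoˡ-≤-nonNeg (u m) {{ℚ.nonNegative 0≤u}} (ℚₚ.≤-trans (p≤∣p∣ (seq x m)) x≤B) ⟩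
      u m * B           <⟨ ℚₚ.*-monoˡ-<-pos B {{ℚ.positive 0<B}} u<ε/B ⟩
      ε * inv B * B     ≡⟨ solve 3 (λ a b c → a :* b :* c := a :* (c :* b)) refl ε (inv B) B ⟩
      ε * (B * inv B)   ≡⟨ cong (ε *_) (*-inv 0<B) ⟩
      ε * 1ℚ            ≡⟨ ℚₚ.*-identityʳ ε ⟩
      ε                 ∎
    ... | inj₂ u≤0 = begin-strict
      u m * seq x m     ≤⟨ ℚₚ.*-monoʳ-≤-nonNeg (seq x m) {{ℚ.nonNegative (0≤x m)}} u≤0 ⟩
      0ℚ * seq x m      ≡⟨ ℚₚ.*-zeroˡ (seq x m) ⟩
      0ℚ                <⟨ 0<ε ⟩
      ε                 ∎

  limNonPos-+null : ∀ {u v} → LimNonPos u → Null v → LimNonPos (λ m → u m + v m)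
  limNonPos-+null {u} {v} lu nv {ε} 0<ε with lu (half-pos 0<ε) | nv (half-pos 0<ε)
  ... | M , f | N , g = M ℕ.⊔ N , λ {m} p → subst (u m + v m <_) (half+half ε)
    (ℚₚ.+-mono-< (f (ℕₚ.m⊔n≤o⇒m≤o M N p)) (ℚₚ.≤-<-trans (p≤∣p∣ (v m)) (g (ℕₚ.m⊔n≤o⇒n≤o M N p))))

  limNonPos-const : ∀ {p} → LimNonPos (λ _ → p) → p ≤ 0ℚ
  limNonPos-const {p} lp with p ℚₚ.≤? 0ℚ
  ... | yes p≤0 = p≤0
  ... | no p≰0  = ⊥-elim (ℚₚ.<-irrefl refl (proj₂ (lp (ℚₚ.≰⇒> p≰0)) ℕₚ.≤-refl))

  -- Square roots by Newton iteration.

  module NewtonStep {x y : ℚ} (0≤x : 0ℚ ≤ x) (0<y : 0ℚ < y) (x≤y² : x ≤ y * y) where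
    -- As `y` bounds the root from above, `z = x / y` bounds it from below; Newton's step is their
    -- mean.
    z y′ : ℚ
    z = x * inv y
    y′ = ½ * (y + z)

    yz≡x : y * z ≡ x
    yz≡x = trans (solve 3 (λ x y i → y :* (x :* i) := x :* (y :* i)) refl x y (inv y))
      (trans (cong (x *_) (*-inv 0<y)) (ℚₚ.*-identityʳ x))

    0≤z : 0ℚ ≤ z
    0≤z = *-nonNeg 0≤x (ℚₚ.<⇒≤ (inv-pos 0<y))

    z≤y : z ≤ y
    z≤y = ℚₚ.*-cancelˡ-≤-pos y {{ℚ.positive 0<y}} (subst (_≤ y * y) (sym yz≡x) x≤y²)

    0<y′ : 0ℚ < y′
    0<y′ = half-pos (ℚₚ.+-mono-<-≤ 0<y 0≤z)

    -- The square of the mean exceeds the product `y * z = x` by the square of half the difference,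
    -- so the new iterate is again above the root.
    excess : y′ * y′ ≡ x + ½ * ½ * ((y - z) * (y - z))
    excess = trans
      (solve 2 (λ y z → (con ½ :* (y :+ z)) :* (con ½ :* (y :+ z)) :=
        y :* z :+ con ½ :* con ½ :* ((y :- z) :* (y :- z))) refl y z)
      (cong (_+ ½ * ½ * ((y - z) * (y - z))) yz≡x)

    x≤y′² : x ≤ y′ * y′
    x≤y′² = ≤-from-diff _ (*-nonNeg (ℚₚ.nonNegative⁻¹ (½ * ½)) (square-nonNeg (y - z))) excess

    -- The old excess is `y * (y - z)` and the new one a quarter of `(y - z) * (y - z)`, where
    -- `y - z` is at most `y`.
    excess-quartered : y′ * y′ - x ≤ ½ * ½ * (y * y - x)
    excess-quartered = ≤-from-diff (½ * ½ * ((y - z) * z))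
      (*-nonNeg (ℚₚ.nonNegative⁻¹ (½ * ½)) (*-nonNeg (≤⇒0≤- z≤y) 0≤z))
      (trans (cong (λ t → ½ * ½ * (y * y - t)) (sym yz≡x))
        (trans (solve 2 (λ y z → con ½ :* con ½ :* (y :* y :- y :* z) :=
            (y :* z :+ con ½ :* con ½ :* ((y :- z) :* (y :- z))) :- y :* z :+ con ½ :* con ½ :* ((y :- z) :* z)) refl y z)
          (cong (_+ ½ * ½ * ((y - z) * z)) (cong₂ _-_ (trans (cong (_+ ½ * ½ * ((y - z) * (y - z))) yz≡x) (sym excess)) yz≡x))))

  -- Since `n + 2` is at most `4 (n + 1)`, quartering the excess more than suffices for decay like
  -- `1 / (n + 1)`, a rate that `archimedean` can use directly.
  newton : ∀ {x} → 0ℚ ≤ x → ∀ n →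
    ∃ λ y → 0ℚ < y × x ≤ y * y × ι (ℤ.+ suc n) * (y * y - x) ≤ (1ℚ + x) * (1ℚ + x) - x
  newton {x} 0≤x zero = 1ℚ + x , ℚₚ.+-mono-<-≤ 0<1 0≤x ,
    ≤-from-diff (1ℚ + x + x * x) (+-nonNeg (+-nonNeg (ℚₚ.<⇒≤ 0<1) 0≤x) (square-nonNeg x))
      (solve 1 (λ x → (con 1ℚ :+ x) :* (con 1ℚ :+ x) := x :+ (con 1ℚ :+ x :+ x :* x)) refl x) ,
    ℚₚ.≤-reflexive (ℚₚ.*-identityˡ _)
  newton {x} 0≤x (suc n) with newton 0≤x n
  ... | y , 0<y , x≤y² , bound = y′ , 0<y′ , x≤y′² , (begin
      ι (ℤ.+ suc (suc n)) * (y′ * y′ - x)   ≤⟨ ℚₚ.*-monoʳ-≤-nonNeg (y′ * y′ - x) {{ℚ.nonNegative (≤⇒0≤- x≤y′²)}} ι≤4ι ⟩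
      4ℚ * N * (y′ * y′ - x)                ≤⟨ ℚₚ.*-monoˡ-≤-nonNeg (4ℚ * N) {{ℚ.nonNegative (*-nonNeg 0≤4 (0≤ι (suc n)))}} excess-quartered ⟩
      4ℚ * N * (½ * ½ * (y * y - x))        ≡⟨ solve 2 (λ N e → con 4ℚ :* N :* (con ½ :* con ½ :* e) := N :* e) refl N (y * y - x) ⟩
      N * (y * y - x)                       ≤⟨ bound ⟩
      (1ℚ + x) * (1ℚ + x) - x               ∎)
    where
    open NewtonStep 0≤x 0<y x≤y²
    open ℚₚ.≤-Reasoning
    2ℚ = ι (ℤ.+ 2)
    3ℚ = ι (ℤ.+ 3)
    4ℚ = ι (ℤ.+ 4)
    N = ι (ℤ.+ suc n)
    0≤4 : 0ℚ ≤ 4ℚ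
    0≤4 = ℚₚ.nonNegative⁻¹ 4ℚ
    ι≤4ι : ι (ℤ.+ suc (suc n)) ≤ 4ℚ * N
    ι≤4ι = ≤-from-diff (2ℚ + 3ℚ * ι (ℤ.+ n))
      (+-nonNeg (ℚₚ.nonNegative⁻¹ 2ℚ) (*-nonNeg (ℚₚ.nonNegative⁻¹ 3ℚ) (0≤ι n)))
      (trans (cong (4ℚ *_) (ι-suc n))
        (trans (solve 1 (λ i → con 4ℚ :* (con 1ℚ :+ i) :=
            con 1ℚ :+ (con 1ℚ :+ i) :+ (con 2ℚ :+ con 3ℚ :* i)) refl (ι (ℤ.+ n)))
          (cong (_+ (2ℚ + 3ℚ * ι (ℤ.+ n)))
            (sym (trans (ι-suc (suc n)) (cong (1ℚ +_) (ι-suc n)))))))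

  approxSqrt : ∀ {x ε} → 0ℚ ≤ x → 0ℚ < ε → ∃ λ y → 0ℚ < y × x ≤ y * y × y * y ≤ x + ε
  approxSqrt {x} {ε} 0≤x 0<ε =
    let n , C≤nε = archimedean ((1ℚ + x) * (1ℚ + x) - x) 0<ε
        y , 0<y , x≤y² , bound = newton 0≤x n
    in y , 0<y , x≤y² , small n (y * y) (ℚₚ.≤-trans bound C≤nε)
    where
    open ℚₚ.≤-Reasoning
    small : ∀ n s → ι (ℤ.+ suc n) * (s - x) ≤ ι (ℤ.+ n) * ε → s ≤ x + ε
    small n s bound = begin
      s              ≡⟨ solve 2 (λ s x → s := x :+ (s :- x)) refl s x ⟩
      x + (s - x)    ≤⟨ ℚₚ.+-monoʳ-≤ x (ℚₚ.*-cancelˡ-≤-pos (ι (ℤ.+ suc n)) {{ℚ.positive (0<ιsuc n)}} excess≤ε) ⟩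
      x + ε          ∎
      where
      excess≤ε : ι (ℤ.+ suc n) * (s - x) ≤ ι (ℤ.+ suc n) * ε
      excess≤ε = ℚₚ.≤-trans bound
        (ℚₚ.*-monoʳ-≤-nonNeg ε {{ℚ.nonNegative (ℚₚ.<⇒≤ 0<ε)}} (ℚₚ.<⇒≤ (ι<ιsuc n)))

  -- For nonnegative numbers `∣ a - b ∣` is at most `a + b`. This is a modulus of continuity for the
  -- square root that is also valid near 0.
  ∣-∣²≤ : ∀ {a b} → 0ℚ ≤ a → 0ℚ ≤ b → ∣ a - b ∣ * ∣ a - b ∣ ≤ ∣ a * a - b * b ∣
  ∣-∣²≤ {a} {b} 0≤a 0≤b = begin
    ∣ a - b ∣ * ∣ a - b ∣    ≤⟨ ℚₚ.*-monoˡ-≤-nonNeg ∣ a - b ∣ {{ℚₚ.∣-∣-nonNeg (a - b)}} ∣a-b∣≤a+b ⟩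
    ∣ a - b ∣ * (a + b)      ≡⟨ cong (∣ a - b ∣ *_) (ℚₚ.0≤p⇒∣p∣≡p (+-nonNeg 0≤a 0≤b)) ⟨
    ∣ a - b ∣ * ∣ a + b ∣    ≡⟨ ℚₚ.∣p*q∣≡∣p∣*∣q∣ (a - b) (a + b) ⟨
    ∣ (a - b) * (a + b) ∣    ≡⟨ cong ∣_∣ (solve 2 (λ a b → (a :- b) :* (a :+ b) := a :* a :- b :* b) refl a b) ⟩
    ∣ a * a - b * b ∣        ∎
    where
    open ℚₚ.≤-Reasoning
    ∣a-b∣≤a+b : ∣ a - b ∣ ≤ a + b
    ∣a-b∣≤a+b = ∣∣≤
      (≤-from-diff (b + b) (+-nonNeg 0≤b 0≤b) (solve 2 (λ a b → a :+ b := (a :- b) :+ (b :+ b)) refl a b))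
      (≤-from-diff (a + a) (+-nonNeg 0≤a 0≤a) (solve 2 (λ a b → a :+ b := (:- (a :- b)) :+ (a :+ a)) refl a b))

  -- The tolerance allowed in the `m`-th approximation of a square root.
  δ : ℕ → ℚ
  δ m = inv (ι (ℤ.+ suc m))

  0<δ : ∀ m → 0ℚ < δ m
  0<δ m = inv-pos (0<ιsuc m)

  null-δ : Null δ
  null-δ {ε} 0<ε =
    let N , 1≤Nε = archimedean 1ℚ 0<ε
    in N , λ {m} N≤m → subst (_< ε) (sym (ℚₚ.0≤p⇒∣p∣≡p (ℚₚ.<⇒≤ (0<δ m)))) (small N m 1≤Nε N≤m)
    where
    open ℚₚ.≤-Reasoning
    small : ∀ N m → 1ℚ ≤ ι (ℤ.+ N) * ε → N ℕ.≤ m → δ m < ε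
    small N m 1≤Nε N≤m = ℚₚ.*-cancelˡ-<-nonNeg (ι (ℤ.+ suc m)) {{ℚ.nonNegative (0≤ι (suc m))}} (begin-strict
      ι (ℤ.+ suc m) * δ m    ≡⟨ *-inv (0<ιsuc m) ⟩
      1ℚ                     ≤⟨ 1≤Nε ⟩
      ι (ℤ.+ N) * ε          ≤⟨ ℚₚ.*-monoʳ-≤-nonNeg ε {{ℚ.nonNegative (ℚₚ.<⇒≤ 0<ε)}} (ι-mono-≤ {ℤ.+ N} {ℤ.+ m} (ℤ.+≤+ N≤m)) ⟩
      ι (ℤ.+ m) * ε          <⟨ ℚₚ.*-monoˡ-<-pos ε {{ℚ.positive 0<ε}} (ι<ιsuc m) ⟩
      ι (ℤ.+ suc m) * ε      ∎)

  module Sqrt (x : ℝ) (0≤x : ∀ m → 0ℚ ≤ seq x m) where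
    root : ℕ → ℚ
    root m = proj₁ (approxSqrt (0≤x m) (0<δ m))

    0≤root : ∀ m → 0ℚ ≤ root m
    0≤root m = ℚₚ.<⇒≤ (proj₁ (proj₂ (approxSqrt (0≤x m) (0<δ m))))

    -- Approximating from above makes lower bounds hold at every index and not only in the limit;
    -- `1≤σ` and `-a≤σ` depend on this.
    ≤root² : ∀ m → seq x m ≤ root m * root m
    ≤root² m = proj₁ (proj₂ (proj₂ (approxSqrt (0≤x m) (0<δ m))))

    root²≤ : ∀ m → root m * root m ≤ seq x m + δ m
    root²≤ m = proj₂ (proj₂ (proj₂ (approxSqrt (0≤x m) (0<δ m))))

    error : ℕ → ℚ
    error m = root m * root m - seq x m

    null-error : Null error
    null-error = null-dominated (λ m → begin
      ∣ error m ∣                   ≡⟨ ℚₚ.0≤p⇒∣p∣≡p (≤⇒0≤- (≤root² m)) ⟩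
      error m                       ≤⟨ ℚₚ.+-monoˡ-≤ (- seq x m) (root²≤ m) ⟩
      seq x m + δ m - seq x m       ≡⟨ solve 2 (λ x d → x :+ d :- x := d) refl (seq x m) (δ m) ⟩
      δ m                           ≤⟨ p≤∣p∣ (δ m) ⟩
      ∣ δ m ∣                       ∎) null-δ
      where open ℚₚ.≤-Reasoning

    -- By `∣-∣²≤` it suffices that the squares differ by less than `ε * ε`: half of this is spent on
    -- `x` and a quarter on each of the two errors.
    root-cauchy : IsCauchy root
    root-cauchy {ε} 0<ε =
      let 0<ε²  = *-pos 0<ε 0<ε
          N , h = cauchy x (half-pos 0<ε²)
          M , e = null-error (half-pos (half-pos 0<ε²))
      in N ℕ.⊔ M , λ {m} {n} p q → square-cancel-< (ℚₚ.<⇒≤ 0<ε) (ℚₚ.≤-<-trans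
        (∣-∣²≤ (0≤root m) (0≤root n))
        (subst (λ t → ∣ t ∣ < ε * ε) (sym (decompose m n))
          (halves (seq x m - seq x n) (error m - error n)
            (h (ℕₚ.m⊔n≤o⇒m≤o N M p) (ℕₚ.m⊔n≤o⇒m≤o N M q))
            (halves (error m) (- error n) (e (ℕₚ.m⊔n≤o⇒n≤o N M p))
              (subst (_< ½ * (½ * (ε * ε))) (sym (ℚₚ.∣-p∣≡∣p∣ (error n))) (e (ℕₚ.m⊔n≤o⇒n≤o N M q)))))))
      where
      decompose : ∀ m n → root m * root m - root n * root n ≡ (seq x m - seq x n) + (error m - error n)
      decompose m n = solve 4 (λ s t x y → s :- t := (x :- y) :+ ((s :- x) :- (t :- y))) refl
        (root m * root m) (root n * root n) (seq x m) (seq x n)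

    sqrt : ℝ
    sqrt = mkℝ root root-cauchy

  -- Reciprocals of reals that are at least 1.

  module Reciprocal (x : ℝ) (1≤x : ∀ m → 1ℚ ≤ seq x m) where
    0<x : ∀ m → 0ℚ < seq x m
    0<x m = ℚₚ.<-≤-trans 0<1 (1≤x m)

    x*inv≡1 : ∀ m → seq x m * inv (seq x m) ≡ 1ℚ
    x*inv≡1 m = *-inv (0<x m)

    ∣inv∣≤1 : ∀ m → ∣ inv (seq x m) ∣ ≤ 1ℚ
    ∣inv∣≤1 m = begin
      ∣ i ∣                ≡⟨ ℚₚ.0≤p⇒∣p∣≡p 0≤i ⟩
      i                    ≡⟨ ℚₚ.*-identityˡ i ⟨
      1ℚ * i               ≤⟨ ℚₚ.*-monoʳ-≤-nonNeg i {{ℚ.nonNegative 0≤i}} (1≤x m) ⟩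
      seq x m * i          ≡⟨ x*inv≡1 m ⟩
      1ℚ                   ∎
      where
      open ℚₚ.≤-Reasoning
      i = inv (seq x m)
      0≤i = ℚₚ.<⇒≤ (inv-pos (0<x m))

    -- On numbers at least 1 the reciprocal is 1-Lipschitz, because `1/x - 1/y = (y - x) / (x y)`.
    -- So the modulus of `x` serves unchanged, with the two indices exchanged.
    inv-cauchy : IsCauchy (λ m → inv (seq x m))
    inv-cauchy {ε} 0<ε with cauchy x 0<ε
    ... | N , h = N , λ {m} {n} p q → ℚₚ.≤-<-trans (lipschitz m n) (h q p)
      where
      open ℚₚ.≤-Reasoning
      lipschitz : ∀ m n → ∣ inv (seq x m) - inv (seq x n) ∣ ≤ ∣ seq x n - seq x m ∣
      lipschitz m n = begin
        ∣ i - j ∣                              ≡⟨ cong ∣_∣ difference ⟩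
        ∣ i * (j * d) ∣                        ≡⟨ ℚₚ.∣p*q∣≡∣p∣*∣q∣ i (j * d) ⟩
        ∣ i ∣ * ∣ j * d ∣                      ≤⟨ ℚₚ.*-monoʳ-≤-nonNeg ∣ j * d ∣ {{ℚₚ.∣-∣-nonNeg (j * d)}} (∣inv∣≤1 m) ⟩
        1ℚ * ∣ j * d ∣                         ≡⟨ ℚₚ.*-identityˡ ∣ j * d ∣ ⟩
        ∣ j * d ∣                              ≡⟨ ℚₚ.∣p*q∣≡∣p∣*∣q∣ j d ⟩
        ∣ j ∣ * ∣ d ∣                          ≤⟨ ℚₚ.*-monoʳ-≤-nonNeg ∣ d ∣ {{ℚₚ.∣-∣-nonNeg d}} (∣inv∣≤1 n) ⟩
        1ℚ * ∣ d ∣                             ≡⟨ ℚₚ.*-identityˡ ∣ d ∣ ⟩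
        ∣ d ∣                                  ∎
        where
        i = inv (seq x m)
        j = inv (seq x n)
        d = seq x n - seq x m
        difference : i - j ≡ i * (j * d)
        difference = trans
          (cong₂ _-_ (sym (trans (cong (i *_) (x*inv≡1 n)) (ℚₚ.*-identityʳ i)))
                     (sym (trans (cong (j *_) (x*inv≡1 m)) (ℚₚ.*-identityʳ j))))
          (solve 4 (λ i j x y → i :* (y :* j) :- j :* (x :* i) := i :* (j :* (y :- x))) refl i j (seq x m) (seq x n))

    reciprocal : ℝ
    reciprocal = mkℝ (λ m → inv (seq x m)) inv-cauchy

-- Finite sums, inner products and matrices over the rationals.

module RationalVectors where
  open ℚ using (ℚ; 0ℚ; 1ℚ; _+_; _*_; _≤_)
  open ℚSolver.+-*-Solver
  open RationalLemmas
  open Sum (CommutativeRing.semiring ℚₚ.+-*-commutativeRing) public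
    using (sum; sum-cong-≗; ∑-distrib-+; ∑-comm; *-distribˡ-sum; *-distribʳ-sum; sum-replicate-zero)
  open ≡-Reasoning

  Vecℚ : ℕ → Set
  Vecℚ n = Fin n → ℚ

  dot : ∀ {n} → Vecℚ n → Vecℚ n → ℚ
  dot u v = sum λ i → u i * v i

  mul : ∀ {n} → (Fin n → Fin n → ℚ) → Vecℚ n → Vecℚ n
  mul M u x = sum λ y → M x y * u y

  lin : ∀ {n} → ℚ → Vecℚ n → ℚ → Vecℚ n → Vecℚ n
  lin p u q v i = p * u i + q * v i

  sum-lin : ∀ {n} p (u : Vecℚ n) q v → sum (lin p u q v) ≡ p * sum u + q * sum v
  sum-lin p u q v = trans (∑-distrib-+ (λ i → p * u i) (λ i → q * v i))
    (sym (cong₂ _+_ (*-distribˡ-sum p u) (*-distribˡ-sum q v)))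

  dot-comm : ∀ {n} (u v : Vecℚ n) → dot u v ≡ dot v u
  dot-comm u v = sum-cong-≗ λ i → ℚₚ.*-comm (u i) (v i)

  dot-linʳ : ∀ {n} (w : Vecℚ n) p u q v → dot w (lin p u q v) ≡ p * dot w u + q * dot w v
  dot-linʳ w p u q v = trans
    (sum-cong-≗ λ i → solve 5 (λ w p u q v → w :* (p :* u :+ q :* v) := p :* (w :* u) :+ q :* (w :* v)) refl (w i) p (u i) q (v i))
    (sum-lin p (λ i → w i * u i) q (λ i → w i * v i))

  dot-const : ∀ {n} (u : Vecℚ n) c → dot u (λ _ → c) ≡ c * sum u
  dot-const u c = trans (sum-cong-≗ λ i → ℚₚ.*-comm (u i) c) (sym (*-distribˡ-sum c u))

  dot-+ʳ : ∀ {n} (u v w : Vecℚ n) → dot u (λ i → v i + w i) ≡ dot u v + dot u w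
  dot-+ʳ u v w = trans (sum-cong-≗ λ i → ℚₚ.*-distribˡ-+ (u i) (v i) (w i)) (∑-distrib-+ _ (λ i → u i * w i))

  mul-lin : ∀ {n} M p (u : Vecℚ n) q v x → mul M (lin p u q v) x ≡ lin p (mul M u) q (mul M v) x
  mul-lin M p u q v x = dot-linʳ (M x) p u q v

  dot-lin-lin : ∀ {n} p (u : Vecℚ n) q v p′ q′ →
    dot (lin p u q v) (lin p′ u q′ v) ≡
      p * p′ * dot u u + (p * q′ + q * p′) * dot u v + q * q′ * dot v v
  dot-lin-lin p u q v p′ q′ = begin
    dot h (lin p′ u q′ v)                 ≡⟨ dot-linʳ h p′ u q′ v ⟩
    p′ * dot h u + q′ * dot h v           ≡⟨ cong₂ (λ s t → p′ * s + q′ * t)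
                                               (trans (dot-comm h u) (dot-linʳ u p u q v))
                                               (trans (dot-comm h v) (trans (dot-linʳ v p u q v)
                                                 (cong (λ t → p * t + q * dot v v) (dot-comm v u)))) ⟩
    p′ * (p * dot u u + q * dot u v) + q′ * (p * dot u v + q * dot v v)
      ≡⟨ solve 7 (λ p q p′ q′ x y z → p′ :* (p :* x :+ q :* y) :+ q′ :* (p :* y :+ q :* z) :=
           p :* p′ :* x :+ (p :* q′ :+ q :* p′) :* y :+ q :* q′ :* z) refl p q p′ q′ (dot u u) (dot u v) (dot v v) ⟩
    p * p′ * dot u u + (p * q′ + q * p′) * dot u v + q * q′ * dot v v ∎
    where h = lin p u q v

  mul-adjoint : ∀ {n} {M : Fin n → Fin n → ℚ} → (∀ x y → M x y ≡ M y x) →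
    ∀ u v → dot (mul M u) v ≡ dot u (mul M v)
  mul-adjoint {M = M} M-sym u v = begin
    sum (λ x → mul M u x * v x)                    ≡⟨ sum-cong-≗ (λ x → *-distribʳ-sum (v x) (λ y → M x y * u y)) ⟩
    sum (λ x → sum λ y → M x y * u y * v x)        ≡⟨ ∑-comm (λ x y → M x y * u y * v x) ⟩
    sum (λ y → sum λ x → M x y * u y * v x)        ≡⟨ sum-cong-≗ (λ y → sum-cong-≗ λ x → trans
        (cong (λ t → t * u y * v x) (M-sym x y))
        (solve 3 (λ m u v → m :* u :* v := u :* (m :* v)) refl (M y x) (u y) (v x))) ⟩
    sum (λ y → sum λ x → u y * (M y x * v x))      ≡⟨ sum-cong-≗ (λ y → *-distribˡ-sum (u y) (λ x → M y x * v x)) ⟨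
    sum (λ y → u y * mul M v y)                    ∎

  mul-mul : ∀ {n} (M : Fin n → Fin n → ℚ) u x → mul M (mul M u) x ≡ sum λ z → (sum λ y → M x y * M y z) * u z
  mul-mul M u x = begin
    sum (λ y → M x y * mul M u y)                        ≡⟨ sum-cong-≗ (λ y → *-distribˡ-sum (M x y) (λ z → M y z * u z)) ⟩
    sum (λ y → sum λ z → M x y * (M y z * u z))          ≡⟨ ∑-comm (λ y z → M x y * (M y z * u z)) ⟩
    sum (λ z → sum λ y → M x y * (M y z * u z))          ≡⟨ sum-cong-≗ (λ z → trans
        (sum-cong-≗ λ y → sym (ℚₚ.*-assoc (M x y) (M y z) (u z)))
        (sym (*-distribʳ-sum (u z) (λ y → M x y * M y z)))) ⟩
    sum (λ z → (sum λ y → M x y * M y z) * u z)          ∎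

  sum-nonNeg : ∀ {n} (u : Vecℚ n) → (∀ i → 0ℚ ≤ u i) → 0ℚ ≤ sum u
  sum-nonNeg {zero}  u 0≤u = ℚₚ.≤-refl
  sum-nonNeg {suc n} u 0≤u = +-nonNeg (0≤u zero) (sum-nonNeg (λ i → u (suc i)) (λ i → 0≤u (suc i)))

  term≤sum : ∀ {n} (u : Vecℚ n) → (∀ i → 0ℚ ≤ u i) → ∀ i → u i ≤ sum u
  term≤sum {suc n} u 0≤u zero    = ≤-from-diff _ (sum-nonNeg (λ i → u (suc i)) (λ i → 0≤u (suc i))) refl
  term≤sum {suc n} u 0≤u (suc i) = ℚₚ.≤-trans (term≤sum (λ i → u (suc i)) (λ i → 0≤u (suc i)) i)
    (≤-from-diff (u zero) (0≤u zero) (ℚₚ.+-comm (u zero) _))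

  -- Indicators and counting.

  𝟙 : ∀ {P : Set} → Dec P → ℚ
  𝟙 P? = if does P? then 1ℚ else 0ℚ

  𝟙-yes : ∀ {P : Set} (P? : Dec P) → P → 𝟙 P? ≡ 1ℚ
  𝟙-yes (yes _) _ = refl
  𝟙-yes (no ¬p) p = ⊥-elim (¬p p)

  𝟙-no : ∀ {P : Set} (P? : Dec P) → ¬ P → 𝟙 P? ≡ 0ℚ
  𝟙-no (yes p) ¬p = ⊥-elim (¬p p)
  𝟙-no (no _)  _  = refl

  𝟙-× : ∀ {P Q : Set} (P? : Dec P) (Q? : Dec Q) → 𝟙 (P? ×-dec Q?) ≡ 𝟙 P? * 𝟙 Q?
  𝟙-× (yes _) (yes _) = refl
  𝟙-× (yes _) (no _)  = refl
  𝟙-× (no _)  (yes _) = refl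
  𝟙-× (no _)  (no _)  = refl

  0≤𝟙 : ∀ {P : Set} (P? : Dec P) → 0ℚ ≤ 𝟙 P?
  0≤𝟙 (yes _) = ℚₚ.<⇒≤ 0<1
  0≤𝟙 (no _)  = ℚₚ.≤-refl

  𝟙≤1 : ∀ {P : Set} (P? : Dec P) → 𝟙 P? ≤ 1ℚ
  𝟙≤1 (yes _) = ℚₚ.≤-refl
  𝟙≤1 (no _)  = ℚₚ.<⇒≤ 0<1

  -- Stated for `tabulate f` so that the induction hypothesis applies to the tail; `allFin` is the
  -- case where `f` is the identity.
  sum-𝟙 : ∀ {n} {B : Set} {P : Pred B 0ℓ} (P? : Decidable P) (f : Fin n → B) →
    sum (λ i → 𝟙 (P? (f i))) ≡ ι (ℤ.+ length (filter P? (tabulate f)))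
  sum-𝟙 {zero}  P? f = refl
  sum-𝟙 {suc n} P? f with P? (f zero)
  ... | yes _ = trans (cong (1ℚ +_) (sum-𝟙 P? (λ i → f (suc i)))) (sym (ι-suc (length (filter P? (tabulate λ i → f (suc i))))))
  ... | no _  = trans (ℚₚ.+-identityˡ _) (sum-𝟙 P? (λ i → f (suc i)))

  δᵥ : ∀ {n} → Fin n → Vecℚ n
  δᵥ x y = 𝟙 (x Finₚ.≟ y)

  δ-diag : ∀ {n} (x : Fin n) → δᵥ x x ≡ 1ℚ
  δ-diag x = 𝟙-yes (x Finₚ.≟ x) refl

  dot-δ : ∀ {n} (x : Fin n) u → dot (δᵥ x) u ≡ u x
  dot-δ {suc n} zero u = begin
    1ℚ * u zero + sum (λ i → 0ℚ * u (suc i))   ≡⟨ cong₂ _+_ (ℚₚ.*-identityˡ (u zero)) (trans (sum-cong-≗ λ i → ℚₚ.*-zeroˡ (u (suc i))) (sum-replicate-zero n)) ⟩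
    u zero + 0ℚ                                ≡⟨ ℚₚ.+-identityʳ (u zero) ⟩
    u zero                                     ∎
  dot-δ {suc n} (suc x) u = begin
    0ℚ * u zero + dot (δᵥ x) (λ i → u (suc i))   ≡⟨ cong₂ _+_ (ℚₚ.*-zeroˡ (u zero)) (dot-δ x (λ i → u (suc i))) ⟩
    0ℚ + u (suc x)                               ≡⟨ ℚₚ.+-identityˡ (u (suc x)) ⟩
    u (suc x)                                    ∎

  filter-nonempty : ∀ {B : Set} {P : Pred B 0ℓ} (P? : Decidable P) xs → 1 ℕ.≤ length (filter P? xs) → ∃ P
  filter-nonempty P? (x ∷ xs) 1≤len with P? x
  ... | yes px = x , px
  ... | no _   = filter-nonempty P? xs 1≤len

-- The adjacency matrix of a strongly regular graph.

module StronglyRegular {n k l μ : ℕ} (G : Graph n) (srg : IsStronglyRegular G k l μ) (1≤μ : 1 ℕ.≤ μ) where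
  open ℚ using (ℚ; 0ℚ; 1ℚ; _+_; _*_; _-_; -_; _≤_)
  open ℚSolver.+-*-Solver
  open RationalLemmas
  open RationalVectors
  open Graph G
  open IsStronglyRegular srg
  open ≡-Reasoning

  K L M a b 2ℚ : ℚ
  K = ι (ℤ.+ k)
  L = ι (ℤ.+ l)
  M = ι (ℤ.+ μ)
  a = L - M
  b = K - M
  2ℚ = ι (ℤ.+ 2)

  A : Fin n → Fin n → ℚ
  A x y = 𝟙 (x ~? y)

  A-sym : ∀ x y → A x y ≡ A y x
  A-sym x y with y ~? x
  ... | yes y~x = 𝟙-yes (x ~? y) (~-sym y~x)
  ... | no y≁x  = 𝟙-no (x ~? y) (λ x~y → y≁x (~-sym x~y))

  A-diag : ∀ x → A x x ≡ 0ℚ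
  A-diag x = 𝟙-no (x ~? x) ~-irrefl

  A-row-sum : ∀ x → sum (A x) ≡ K
  A-row-sum x = trans (sum-𝟙 (x ~?_) (λ i → i)) (cong (λ t → ι (ℤ.+ t)) (degree x))

  dot-A-A : ∀ x y → dot (A x) (A y) ≡ ι (ℤ.+ length (commonNeighbours x y))
  dot-A-A x y = trans (sum-cong-≗ λ z → sym (𝟙-× (x ~? z) (y ~? z)))
    (sum-𝟙 (λ z → (x ~? z) ×-dec (y ~? z)) (λ i → i))

  dot-A-self : ∀ x → dot (A x) (A x) ≡ K
  dot-A-self x = trans (sum-cong-≗ λ z → idem (x ~? z)) (A-row-sum x)
    where
    idem : ∀ {P : Set} (P? : Dec P) → 𝟙 P? * 𝟙 P? ≡ 𝟙 P?
    idem (yes _) = refl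
    idem (no _)  = refl

  -- Each case carries the entries of `I` and `A` next to the combinatorial fact, so that a matrix
  -- identity becomes three evaluations of a polynomial.
  data Relation (x y : Fin n) : Set where
    same    : x ≡ y → δᵥ x y ≡ 1ℚ → A x y ≡ 0ℚ → Relation x y
    edge    : x ≢ y → x ~ y → δᵥ x y ≡ 0ℚ → A x y ≡ 1ℚ → Relation x y
    nonedge : x ≢ y → ¬ x ~ y → δᵥ x y ≡ 0ℚ → A x y ≡ 0ℚ → Relation x y

  relation : ∀ x y → Relation x y
  relation x y with x Finₚ.≟ y in eq
  ... | yes refl = same refl (cong 𝟙 eq) (A-diag x)
  ... | no x≢y with x ~? y in eq′
  ...   | yes x~y = edge x≢y x~y (cong 𝟙 eq) (cong 𝟙 eq′)
  ...   | no x≁y  = nonedge x≢y x≁y (cong 𝟙 eq) (cong 𝟙 eq′)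

  -- By symmetry of `A` the entry counts common neighbours: `K`, `L` or `M` according to the
  -- relation of `x` and `z`. The coefficients `a` and `b` are chosen to fit these three values.
  A²-entry : ∀ x z → sum (λ y → A x y * A y z) ≡ a * A x z + b * δᵥ x z + M
  A²-entry x z = trans (sum-cong-≗ λ y → cong (A x y *_) (A-sym y z)) (cases (relation x z))
    where
    entry : ∀ {c p q} → dot (A x) (A z) ≡ c → A x z ≡ p → δᵥ x z ≡ q →
      c ≡ a * p + b * q + M → dot (A x) (A z) ≡ a * A x z + b * δᵥ x z + M
    entry c≡ A≡ δ≡ eq = trans c≡ (trans eq (sym (cong₂ (λ p q → a * p + b * q + M) A≡ δ≡)))
    cases : Relation x z → dot (A x) (A z) ≡ a * A x z + b * δᵥ x z + M
    cases (same refl δ≡ A≡) = entry (dot-A-self x) A≡ δ≡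
      (solve 3 (λ K L M → K := (L :- M) :* con 0ℚ :+ (K :- M) :* con 1ℚ :+ M) refl K L M)
    cases (edge _ x~z δ≡ A≡) = entry (trans (dot-A-A x z) (cong (λ t → ι (ℤ.+ t)) (adjacent x~z))) A≡ δ≡
      (solve 3 (λ K L M → L := (L :- M) :* con 1ℚ :+ (K :- M) :* con 0ℚ :+ M) refl K L M)
    cases (nonedge x≢z x≁z δ≡ A≡) = entry (trans (dot-A-A x z) (cong (λ t → ι (ℤ.+ t)) (nonAdjacent x≢z x≁z))) A≡ δ≡
      (solve 3 (λ K L M → M := (L :- M) :* con 0ℚ :+ (K :- M) :* con 0ℚ :+ M) refl K L M)

  -- The all-ones part contributes `γ * sum u`. It is kept because rational approximants of a vector
  -- orthogonal to `𝟏` need not have sum zero.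
  dot-combination : ∀ α β γ {v : Vecℚ n} x → (∀ z → v z ≡ α * A x z + β * δᵥ x z + γ) →
    ∀ u → dot v u ≡ lin α (mul A u) β u x + γ * sum u
  dot-combination α β γ {v} x v≡ u = begin
    dot v u                                       ≡⟨ sum-cong-≗ (λ z → trans (cong (_* u z) (v≡ z))
        (solve 6 (λ α A β d γ u → (α :* A :+ β :* d :+ γ) :* u := (α :* (A :* u) :+ β :* (d :* u)) :+ γ :* u)
          refl α (A x z) β (δᵥ x z) γ (u z))) ⟩
    sum (λ z → lin α Au β δu z + γ * u z)         ≡⟨ ∑-distrib-+ (lin α Au β δu) (λ z → γ * u z) ⟩
    sum (lin α Au β δu) + sum (λ z → γ * u z)     ≡⟨ cong₂ _+_ (sum-lin α Au β δu) (sym (*-distribˡ-sum γ u)) ⟩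
    α * sum Au + β * sum δu + γ * sum u           ≡⟨ cong (λ t → α * sum Au + β * t + γ * sum u) (dot-δ x u) ⟩
    lin α (mul A u) β u x + γ * sum u             ∎
    where
    Au δu : Vecℚ n
    Au z = A x z * u z
    δu z = δᵥ x z * u z

  A²-apply : ∀ u x → mul A (mul A u) x ≡ lin a (mul A u) b u x + M * sum u
  A²-apply u x = trans (mul-mul A u x) (dot-combination a b M x (A²-entry x) u)

  dot-quadratic : ∀ α β γ {v} u → (∀ x → v x ≡ lin α (mul A u) β u x + γ * sum u) →
    dot u v ≡ α * dot u (mul A u) + β * dot u u + γ * sum u * sum u
  dot-quadratic α β γ {v} u v≡ = begin
    dot u v                                                  ≡⟨ sum-cong-≗ (λ x → cong (u x *_) (v≡ x)) ⟩
    dot u (λ x → lin α (mul A u) β u x + γ * sum u)          ≡⟨ dot-+ʳ u (lin α (mul A u) β u) (λ _ → γ * sum u) ⟩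
    dot u (lin α (mul A u) β u) + dot u (λ _ → γ * sum u)    ≡⟨ cong₂ _+_ (dot-linʳ u α (mul A u) β u) (dot-const u (γ * sum u)) ⟩
    α * dot u (mul A u) + β * dot u u + γ * sum u * sum u    ∎

  -- As `A` is symmetric, the squared norm of `A u` is the quadratic form of `A²` at `u`.
  normSq-A : ∀ u → dot (mul A u) (mul A u) ≡ a * dot u (mul A u) + b * dot u u + M * sum u * sum u
  normSq-A u = trans (mul-adjoint A-sym u (mul A u)) (dot-quadratic a b M u (A²-apply u))

  sum-A : ∀ u → sum (mul A u) ≡ K * sum u
  sum-A u = begin
    sum (λ x → sum λ y → A x y * u y)      ≡⟨ ∑-comm (λ x y → A x y * u y) ⟩
    sum (λ y → sum λ x → A x y * u y)      ≡⟨ sum-cong-≗ (λ y → trans (sym (*-distribʳ-sum (u y) (λ x → A x y)))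
                                                (cong (_* u y) (trans (sum-cong-≗ λ x → A-sym x y) (A-row-sum y)))) ⟩
    sum (λ y → K * u y)                    ≡⟨ *-distribˡ-sum K u ⟨
    K * sum u                              ∎

  -- Distances are 0, 1 or 2.

  conn : Connected
  conn = srg-connected srg 1≤μ

  commonNeighbour : ∀ {x y} → x ≢ y → ¬ x ~ y → ∃ λ z → x ~ z × y ~ z
  commonNeighbour {x} {y} x≢y x≁y = filter-nonempty (λ z → (x ~? z) ×-dec (y ~? z)) (allFin n)
    (subst (1 ℕ.≤_) (sym (nonAdjacent x≢y x≁y)) 1≤μ)

  dist-walk : ∀ x y → Walk x y (dist G conn x y)
  dist-walk x y = proj₁ (proj₂ (least (walk? x y) (proj₁ (conn x y)) (proj₂ (conn x y))))

  dist-least : ∀ x y {j} → Walk x y j → dist G conn x y ℕ.≤ j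
  dist-least x y = proj₂ (proj₂ (least (walk? x y) (proj₁ (conn x y)) (proj₂ (conn x y))))

  walk≡ : ∀ {x y} → Walk x y 0 → x ≡ y
  walk≡ [] = refl

  walk~ : ∀ {x y} → Walk x y 1 → x ~ y
  walk~ (e ∷ []) = e

  dist-equal : ∀ x → dist G conn x x ≡ 0
  dist-equal x = ℕₚ.n≤0⇒n≡0 (dist-least x x [])

  dist-adjacent : ∀ {x y} → x ≢ y → x ~ y → dist G conn x y ≡ 1
  dist-adjacent {x} {y} x≢y x~y = ℕₚ.≤-antisym (dist-least x y (x~y ∷ []))
    (ℕₚ.n≢0⇒n>0 λ d≡0 → x≢y (walk≡ (subst (Walk x y) d≡0 (dist-walk x y))))

  dist-nonadjacent : ∀ {x y} → x ≢ y → ¬ x ~ y → dist G conn x y ≡ 2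
  dist-nonadjacent {x} {y} x≢y x≁y with commonNeighbour x≢y x≁y
  ... | z , x~z , y~z = ℕₚ.≤-antisym (dist-least x y (x~z ∷ ~-sym y~z ∷ [])) (lower (dist-walk x y))
    where
    lower : ∀ {d} → Walk x y d → 2 ℕ.≤ d
    lower {0} w = ⊥-elim (x≢y (walk≡ w))
    lower {1} w = ⊥-elim (x≁y (walk~ w))
    lower {suc (suc d)} w = ℕ.s≤s (ℕ.s≤s ℕ.z≤n)

  -- The entry of `2J - 2I - A`, in the coefficient form that `dot-combination` takes.
  DistanceEntry : ℚ → Fin n → Fin n → Set
  DistanceEntry t x y = t ≡ - 1ℚ * A x y + - 2ℚ * δᵥ x y + 2ℚ

  D-entry : ∀ m x y → DistanceEntry (seq (distanceMatrix G conn x y) m) x y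
  D-entry m x y = cases (relation x y)
    where
    entry : ∀ {d p q} → dist G conn x y ≡ d → A x y ≡ p → δᵥ x y ≡ q →
      ι (ℤ.+ d) ≡ - 1ℚ * p + - 2ℚ * q + 2ℚ →
      DistanceEntry (seq (distanceMatrix G conn x y) m) x y
    entry d≡ A≡ δ≡ eq = trans (cong (λ d → seq (fromℕ d) m) d≡)
      (trans eq (sym (cong₂ (λ p q → - 1ℚ * p + - 2ℚ * q + 2ℚ) A≡ δ≡)))
    cases : Relation x y → DistanceEntry (seq (distanceMatrix G conn x y) m) x y
    cases (same refl δ≡ A≡)       = entry (dist-equal x) A≡ δ≡ refl
    cases (edge x≢y x~y δ≡ A≡)    = entry (dist-adjacent x≢y x~y) A≡ δ≡ refl
    cases (nonedge x≢y x≁y δ≡ A≡) = entry (dist-nonadjacent x≢y x≁y) A≡ δ≡ refl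

  dot-combination-quadratic : ∀ α β γ {N : Fin n → Fin n → ℚ} →
    (∀ x y → N x y ≡ α * A x y + β * δᵥ x y + γ) →
    ∀ u → dot u (mul N u) ≡ α * dot u (mul A u) + β * dot u u + γ * sum u * sum u
  dot-combination-quadratic α β γ N≡ u = dot-quadratic α β γ u λ x → dot-combination α β γ x (N≡ x) u

  -- Parameter inequalities from counting neighbours of `x` that are not neighbours of `y`.

  degree-minus-common : ∀ x y → sum (λ z → A x z * (1ℚ - A y z)) ≡ K - ι (ℤ.+ length (commonNeighbours x y))
  degree-minus-common x y = begin
    sum (λ z → A x z * (1ℚ - A y z))                          ≡⟨ sum-cong-≗ (λ z → solve 2 (λ p q → p :* (con 1ℚ :- q) := con 1ℚ :* p :+ con (- 1ℚ) :* (p :* q)) refl (A x z) (A y z)) ⟩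
    sum (lin 1ℚ (A x) (- 1ℚ) (λ z → A x z * A y z))           ≡⟨ sum-lin 1ℚ (A x) (- 1ℚ) (λ z → A x z * A y z) ⟩
    1ℚ * sum (A x) + - 1ℚ * dot (A x) (A y)                   ≡⟨ cong₂ (λ s t → 1ℚ * s + - 1ℚ * t) (A-row-sum x) (dot-A-A x y) ⟩
    1ℚ * K + - 1ℚ * C                                         ≡⟨ solve 2 (λ s t → con 1ℚ :* s :+ con (- 1ℚ) :* t := s :- t) refl K C ⟩
    K - C                                                     ∎
    where C = ι (ℤ.+ length (commonNeighbours x y))

  outside-nonNeg : ∀ x y z → 0ℚ ≤ A x z * (1ℚ - A y z)
  outside-nonNeg x y z = *-nonNeg (0≤𝟙 (x ~? z)) (≤⇒0≤- (𝟙≤1 (y ~? z)))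

  0≤b : ∀ {x y} → x ≢ y → ¬ x ~ y → 0ℚ ≤ b
  0≤b {x} {y} x≢y x≁y = subst (0ℚ ≤_)
    (trans (degree-minus-common x y) (cong (λ t → K - ι (ℤ.+ t)) (nonAdjacent x≢y x≁y)))
    (sum-nonNeg (λ z → A x z * (1ℚ - A y z)) (outside-nonNeg x y))

  -- The vertex `y` itself is counted: it is a neighbour of `x` but not of itself.
  1≤K-L : ∀ {x y} → x ~ y → 1ℚ ≤ K - L
  1≤K-L {x} {y} x~y = subst (1ℚ ≤_)
    (trans (degree-minus-common x y) (cong (λ t → K - ι (ℤ.+ t)) (adjacent x~y)))
    (subst (_≤ sum (λ z → A x z * (1ℚ - A y z)))
      (cong₂ (λ s t → s * (1ℚ - t)) (𝟙-yes (x ~? y) x~y) (A-diag y))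
      (term≤sum (λ z → A x z * (1ℚ - A y z)) (outside-nonNeg x y) y))

  -- The `A`-invariant span of an edge vector and its image.

  module EdgeVector {x y : Fin n} (x~y : x ~ y) where
    g : Vecℚ n
    g = lin 1ℚ (δᵥ x) (- 1ℚ) (δᵥ y)

    dot-g : ∀ v → dot v g ≡ 1ℚ * v x + - 1ℚ * v y
    dot-g v = trans (dot-linʳ v 1ℚ (δᵥ x) (- 1ℚ) (δᵥ y))
      (cong₂ (λ s t → 1ℚ * s + - 1ℚ * t) (trans (dot-comm v (δᵥ x)) (dot-δ x v)) (trans (dot-comm v (δᵥ y)) (dot-δ y v)))

    x≢y : x ≢ y
    x≢y refl = ~-irrefl x~y

    dot-g-g : dot g g ≡ 2ℚ
    dot-g-g = trans (dot-g g) (cong₂ (λ s t → 1ℚ * s + - 1ℚ * t)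
      (cong₂ (λ s t → 1ℚ * s + - 1ℚ * t) (δ-diag x) (𝟙-no (y Finₚ.≟ x) (λ y≡x → x≢y (sym y≡x))))
      (cong₂ (λ s t → 1ℚ * s + - 1ℚ * t) (𝟙-no (x Finₚ.≟ y) x≢y) (δ-diag y)))

    dot-Ag-g : dot (mul A g) g ≡ - 2ℚ
    dot-Ag-g = trans (dot-g (mul A g)) (cong₂ (λ s t → 1ℚ * s + - 1ℚ * t)
      (trans (dot-g (A x)) (cong₂ (λ s t → 1ℚ * s + - 1ℚ * t) (A-diag x) (𝟙-yes (x ~? y) x~y)))
      (trans (dot-g (A y)) (cong₂ (λ s t → 1ℚ * s + - 1ℚ * t) (𝟙-yes (y ~? x) (~-sym x~y)) (A-diag y))))

    sum-g : sum g ≡ 0ℚ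
    sum-g = trans (sum-cong-≗ λ i → sym (ℚₚ.*-identityˡ (g i))) (dot-g (λ _ → 1ℚ))

    dot-Ag-Ag : dot (mul A g) (mul A g) ≡ a * - 2ℚ + b * 2ℚ
    dot-Ag-Ag = trans (normSq-A g) (trans
      (cong₂ _+_ (cong₂ (λ s t → a * s + b * t) (trans (dot-comm g (mul A g)) dot-Ag-g) dot-g-g)
        (cong (λ t → M * t * t) sum-g))
      (solve 2 (λ s M → s :+ M :* con 0ℚ :* con 0ℚ := s) refl (a * - 2ℚ + b * 2ℚ) M))

    module _ (p q : ℚ) where
      -- The scalars stay free: at each index of a real sequence they become rational approximations
      -- of the coefficients of a multiple of `A - r`.
      f : Vecℚ n
      f = lin p (mul A g) q g

      sum-f : sum f ≡ 0ℚ
      sum-f = trans (sum-lin p (mul A g) q g) (trans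
        (cong₂ (λ s t → p * s + q * t) (trans (sum-A g) (cong (K *_) sum-g)) sum-g)
        (solve 3 (λ p q K → p :* (K :* con 0ℚ) :+ q :* con 0ℚ := con 0ℚ) refl p q K))

      dot-lin-g : ∀ p′ q′ → dot f (lin p′ (mul A g) q′ g) ≡
        p * p′ * (a * - 2ℚ + b * 2ℚ) + (p * q′ + q * p′) * - 2ℚ + q * q′ * 2ℚ
      dot-lin-g p′ q′ = trans (dot-lin-lin p (mul A g) q g p′ q′)
        (cong₂ _+_ (cong₂ (λ s t → p * p′ * s + (p * q′ + q * p′) * t) dot-Ag-Ag dot-Ag-g)
          (cong (q * q′ *_) dot-g-g))

      -- Since `g` has sum zero, `A²` acts on it as `a A + b`, which keeps the image in the span of
      -- `A g` and `g`.
      A-f : ∀ z → mul A f z ≡ lin (p * a + q) (mul A g) (p * b) g z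
      A-f z = trans (mul-lin A p (mul A g) q g z) (trans
        (cong (λ t → p * t + q * mul A g z) (trans (A²-apply g z) (cong (λ t → lin a (mul A g) b g z + M * t) sum-g)))
        (solve 7 (λ p q a b M u v → p :* (a :* u :+ b :* v :+ M :* con 0ℚ) :+ q :* u :=
          (p :* a :+ q) :* u :+ p :* b :* v) refl p q a b M (mul A g z) (g z)))

      dot-f-Af : dot f (mul A f) ≡
        p * (p * a + q) * (a * - 2ℚ + b * 2ℚ) + (p * (p * b) + q * (p * a + q)) * - 2ℚ + q * (p * b) * 2ℚ
      dot-f-Af = trans (sum-cong-≗ λ z → cong (f z *_) (A-f z)) (dot-lin-g (p * a + q) (p * b))

-- The quadratic embedding constant in terms of the smaller eigenvalue `s`.

module QuadraticEmbedding {n k l μ : ℕ} (G : Graph n) (srg : IsStronglyRegular G k l μ) (1≤μ : 1 ℕ.≤ μ)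
  {x₀ y₀ z₀ : Fin n} (x₀≢y₀ : x₀ ≢ y₀) (x₀≁y₀ : ¬ Graph._~_ G x₀ y₀) (x₀~z₀ : Graph._~_ G x₀ z₀)
  -- Knowing `D` only through its entries keeps the computation of distances out of the terms below.
  (D : Matrix n) (D-entry : ∀ m x y → StronglyRegular.DistanceEntry G srg 1≤μ (seq (D x y) m) x y) where
  open ℚ using (ℚ; 0ℚ; 1ℚ; ½; _+_; _*_; _-_; -_; _≤_; _<_)
  open ℚSolver.+-*-Solver
  open RationalLemmas
  open RationalVectors
  open RealLemmas
  open StronglyRegular G srg 1≤μ hiding (D-entry)
  open EdgeVector x₀~z₀

  4ℚ : ℚ
  4ℚ = ι (ℤ.+ 4)

  seq-∑ : ∀ {n} (v : Vector ℝ n) m → seq (∑ v) m ≡ sum (λ i → seq (v i) m)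
  seq-∑ {zero}  v m = refl
  seq-∑ {suc n} v m = cong (seq (v zero) m +_) (seq-∑ (λ i → v (suc i)) m)

  at : ∀ {n} → Vector ℝ n → ℕ → Vecℚ n
  at f m i = seq (f i) m

  seq-dot : ∀ {n} (f g : Vector ℝ n) m → seq ⟨ f , g ⟩ m ≡ dot (at f m) (at g m)
  seq-dot f g m = seq-∑ (λ i → f i *ᴿ g i) m

  seq-sum : ∀ {n} (f : Vector ℝ n) m → seq ⟨ 𝟏 , f ⟩ m ≡ sum (at f m)
  seq-sum f m = trans (seq-dot 𝟏 f m) (sum-cong-≗ λ i → ℚₚ.*-identityˡ (at f m i))

  seq-quadratic : ∀ {n} (N : Matrix n) f m →
    seq ⟨ f , N · f ⟩ m ≡ dot (at f m) (mul (λ x y → seq (N x y) m) (at f m))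
  seq-quadratic N f m = trans (seq-dot f (N · f) m)
    (sum-cong-≗ λ x → cong (at f m x *_) (seq-∑ (λ y → N x y *ᴿ f y) m))

  seq-form : ∀ f m → seq ⟨ f , D · f ⟩ m ≡
    - 1ℚ * dot (at f m) (mul A (at f m)) + - 2ℚ * dot (at f m) (at f m) + 2ℚ * sum (at f m) * sum (at f m)
  seq-form f m = trans (seq-quadratic (D) f m)
    (dot-combination-quadratic (- 1ℚ) (- 2ℚ) 2ℚ (D-entry m) (at f m))

  -- The discriminant and the eigenvalues.

  b-a≥1 : 1ℚ ≤ b - a
  b-a≥1 = subst (1ℚ ≤_) (solve 3 (λ K L M → K :- L := (K :- M) :- (L :- M)) refl K L M) (1≤K-L x₀~z₀)

  b≥0 : 0ℚ ≤ b
  b≥0 = 0≤b x₀≢y₀ x₀≁y₀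

  -- The discriminant of `X² - a X - b`.
  Δ : ℚ
  Δ = a * a + 4ℚ * b

  -- The gap `r - s` is the root of `Δ`. Keeping it at least 1 lets the estimates below be divided
  -- by it.
  1≤Δ : 1ℚ ≤ Δ
  1≤Δ = ≤-from-diff ((a + 1ℚ) * (a + 1ℚ) + 2ℚ * b + 2ℚ * (b - a - 1ℚ))
    (+-nonNeg (+-nonNeg (square-nonNeg (a + 1ℚ)) (*-nonNeg (0≤ι 2) b≥0)) (*-nonNeg (0≤ι 2) (≤⇒0≤- b-a≥1)))
    (solve 2 (λ a b → a :* a :+ con 4ℚ :* b := con 1ℚ :+
      ((a :+ con 1ℚ) :* (a :+ con 1ℚ) :+ con 2ℚ :* b :+ con 2ℚ :* (b :- a :- con 1ℚ))) refl a b)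

  a²≤Δ : (- a) * (- a) ≤ Δ
  a²≤Δ = ≤-from-diff (4ℚ * b) (*-nonNeg (0≤ι 4) b≥0)
    (solve 2 (λ a b → a :* a :+ con 4ℚ :* b := (:- a) :* (:- a) :+ con 4ℚ :* b) refl a b)

  open Sqrt (fromℚ Δ) (λ _ → ℚₚ.≤-trans (ℚₚ.<⇒≤ 0<1) 1≤Δ) renaming (sqrt to σ)

  1≤σ : ∀ m → 1ℚ ≤ seq σ m
  1≤σ m = square-cancel-≤ (0≤root m) (ℚₚ.≤-trans 1≤Δ (≤root² m))

  -a≤σ : ∀ m → - a ≤ seq σ m
  -a≤σ m = square-cancel-≤ (0≤root m) (ℚₚ.≤-trans a²≤Δ (≤root² m))

  -- The eigenvalues of A on the complement of 𝟏, with r + s = a and r s = - b.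
  r s q : ℝ
  r = fromℚ ½ *ᴿ (fromℚ a +ᴿ σ)
  s = fromℚ ½ *ᴿ (fromℚ a +ᴿ fromℚ (- 1ℚ) *ᴿ σ)
  q = fromℚ (- 2ℚ) +ᴿ fromℚ (- 1ℚ) *ᴿ s

  E : ℕ → ℚ
  E m = b + seq r m * seq s m

  -- At every index `r + s` is exactly `a`, while `E` is minus a quarter of the error made in the
  -- square root of `Δ`.
  null-E : Null E
  null-E = null-resp
    (λ m → solve 3 (λ a b σ → b :+ (con ½ :* (a :+ σ)) :* (con ½ :* (a :+ con (- 1ℚ) :* σ)) :=
      con (- (½ * ½)) :* (σ :* σ :- (a :* a :+ con 4ℚ :* b))) refl a b (seq σ m))
    (null-* (fromℚ (- (½ * ½))) null-error)

  -- The upper bound on admissible vectors.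

  upper-identity : ∀ a b M σ X Y S →
    let s = ½ * (a + - 1ℚ * σ)
        E = b + ½ * (a + σ) * s
    in X * E + (M * S * S + (- 1ℚ * (σ * (s + 2ℚ)) * (X - 1ℚ) + 2ℚ * σ * S * S)) ≡
       ((- 1ℚ * Y + - 2ℚ * X + 2ℚ * S * S) - (- 2ℚ + - 1ℚ * s)) * σ +
       (1ℚ * 1ℚ * (a * Y + b * X + M * S * S) + (1ℚ * (- 1ℚ * s) + - 1ℚ * s * 1ℚ) * Y + - 1ℚ * s * (- 1ℚ * s) * X)
  upper-identity = solve 7 (λ a b M σ X Y S →
    let s = con ½ :* (a :+ con (- 1ℚ) :* σ)
        E = b :+ con ½ :* (a :+ σ) :* s
    in X :* E :+ (M :* S :* S :+ (con (- 1ℚ) :* (σ :* (s :+ con 2ℚ)) :* (X :- con 1ℚ) :+ con 2ℚ :* σ :* S :* S)) :=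
       ((con (- 1ℚ) :* Y :+ con (- 2ℚ) :* X :+ con 2ℚ :* S :* S) :- (con (- 2ℚ) :+ con (- 1ℚ) :* s)) :* σ :+
       (con 1ℚ :* con 1ℚ :* (a :* Y :+ b :* X :+ M :* S :* S) :+ (con 1ℚ :* (con (- 1ℚ) :* s) :+ con (- 1ℚ) :* s :* con 1ℚ) :* Y :+ con (- 1ℚ) :* s :* (con (- 1ℚ) :* s) :* X)) refl

  -- In `upper-identity`, `X`, `Y` and `S` are the values of `⟨u,u⟩`, `⟨u,Au⟩` and the sum of an
  -- approximant `u`, and the last bracket on the right is the squared norm of `(A - s) u`. Dropping
  -- this square bounds `(d - q) σ` by a null sequence, and the factor `σ`, at least 1, cancels.
  upper : ∀ f → ⟨ f , f ⟩ ≈ᴿ 1ᴿ × ⟨ 𝟏 , f ⟩ ≈ᴿ 0ᴿ → ⟨ f , D · f ⟩ ≤ᴿ q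
  upper f (norm , orth) {ε} 0<ε =
    let N , h = limNonPos-cancel 1≤σ (limNonPos-dominated bound (null⇒limNonPos null-z)) 0<ε
    in N , λ {m} p → subst (_< seq q m + ε) (solve 2 (λ d q → q :+ (d :- q) := d) refl (d m) (seq q m))
         (ℚₚ.+-monoʳ-< (seq q m) (h p))
    where
    d X Y S z : ℕ → ℚ
    d = seq ⟨ f , D · f ⟩
    X = seq ⟨ f , f ⟩
    Y m = dot (at f m) (mul A (at f m))
    S = seq ⟨ 𝟏 , f ⟩
    -- Every summand has a null factor: `E`, `S` or `X - 1`.
    z m = X m * E m + (M * S m * S m + (- 1ℚ * (seq σ m * (seq s m + 2ℚ)) * (X m - 1ℚ) + 2ℚ * seq σ m * S m * S m))

    null-S : Null S
    null-S = null-resp (λ m → solve 1 (λ x → x := x :- con 0ℚ) refl (S m)) orth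

    null-z : Null z
    null-z = null-+ (null-* ⟨ f , f ⟩ null-E) (null-+ (null-* (fromℚ M *ᴿ ⟨ 𝟏 , f ⟩) null-S)
      (null-+ (null-* (fromℚ (- 1ℚ) *ᴿ (σ *ᴿ (s +ᴿ fromℚ 2ℚ))) norm)
        (null-* (fromℚ 2ℚ *ᴿ σ *ᴿ ⟨ 𝟏 , f ⟩) null-S)))

    h : ∀ m → Vecℚ n
    h m = lin 1ℚ (mul A (at f m)) (- 1ℚ * seq s m) (at f m)

    dot-h : ∀ m → dot (h m) (h m) ≡ 1ℚ * 1ℚ * (a * Y m + b * X m + M * S m * S m) +
      (1ℚ * (- 1ℚ * seq s m) + - 1ℚ * seq s m * 1ℚ) * Y m + - 1ℚ * seq s m * (- 1ℚ * seq s m) * X m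
    dot-h m = trans (dot-lin-lin 1ℚ (mul A u) (- 1ℚ * seq s m) u 1ℚ (- 1ℚ * seq s m))
      (cong₂ _+_
        (cong₂ (λ α β → 1ℚ * 1ℚ * α + (1ℚ * (- 1ℚ * seq s m) + - 1ℚ * seq s m * 1ℚ) * β)
          (trans (normSq-A u) (cong₂ (λ α β → a * Y m + b * α + M * β * β) (sym (seq-dot f f m)) (sym (seq-sum f m))))
          (dot-comm (mul A u) u))
        (cong (- 1ℚ * seq s m * (- 1ℚ * seq s m) *_) (sym (seq-dot f f m))))
      where u = at f m

    bound : ∀ m → (d m - seq q m) * seq σ m ≤ z m
    bound m = ≤-from-diff (dot (h m) (h m)) (sum-nonNeg _ (λ i → square-nonNeg (h m i)))
      (trans (upper-identity a b M (seq σ m) (X m) (Y m) (S m))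
        (sym (cong₂ (λ α β → (α - seq q m) * seq σ m + β)
          (trans (seq-form f m) (cong₂ (λ α β → - 1ℚ * Y m + - 2ℚ * α + 2ℚ * β * β)
            (sym (seq-dot f f m)) (sym (seq-sum f m))))
          (dot-h m))))

  -- Attaining the bound at a normalised eigenvector.

  2+a+σ≥1 : ∀ m → 1ℚ ≤ 2ℚ + a + seq σ m
  2+a+σ≥1 m = ≤-from-diff (1ℚ + (seq σ m - - a)) (+-nonNeg (ℚₚ.<⇒≤ 0<1) (≤⇒0≤- (-a≤σ m)))
    (solve 2 (λ a σ → con 2ℚ :+ a :+ σ := con 1ℚ :+ (con 1ℚ :+ (σ :- (:- a)))) refl a (seq σ m))

  -- The squared norm 2 (r - s) (1 + r) of the eigenvector A g - r g.
  c : ℝ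
  c = σ *ᴿ (fromℚ (2ℚ + a) +ᴿ σ)

  1≤c : ∀ m → 1ℚ ≤ seq c m
  1≤c m = begin
    1ℚ                               ≤⟨ 1≤σ m ⟩
    seq σ m                          ≡⟨ ℚₚ.*-identityʳ (seq σ m) ⟨
    seq σ m * 1ℚ                     ≤⟨ ℚₚ.*-monoˡ-≤-nonNeg (seq σ m) {{ℚ.nonNegative (0≤root m)}} (2+a+σ≥1 m) ⟩
    seq σ m * (2ℚ + a + seq σ m)     ∎
    where open ℚₚ.≤-Reasoning

  open Reciprocal c 1≤c

  -- The normalising factor `w` is the square root of `1 / c`.
  open Sqrt reciprocal (λ m → ℚₚ.<⇒≤ (inv-pos (0<x m)))
    using () renaming (sqrt to w; error to w-error; null-error to null-w-error)

  -- At each index this is the combination `f p q′` of `A g` and `g` with `p = w` and `q′ = - w r`.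
  -- Its sum is therefore exactly zero, while norm and value are right only up to null terms.
  eigenvector : Vector ℝ n
  eigenvector i = w *ᴿ fromℚ (mul A g i) +ᴿ (fromℚ (- 1ℚ) *ᴿ w *ᴿ r) *ᴿ fromℚ (g i)

  module Eigenvector where
    p q′ : ℕ → ℚ
    p m = seq w m
    q′ m = - 1ℚ * seq w m * seq r m

    X d : ℕ → ℚ
    X = seq ⟨ eigenvector , eigenvector ⟩
    d = seq ⟨ eigenvector , D · eigenvector ⟩

    seq-𝟏 : ∀ m → seq ⟨ 𝟏 , eigenvector ⟩ m ≡ 0ℚ
    seq-𝟏 m = trans (seq-sum eigenvector m) (sum-f (p m) (q′ m))

    orthogonal : ⟨ 𝟏 , eigenvector ⟩ ≈ᴿ 0ᴿ
    orthogonal = null-resp (λ m → cong (_- 0ℚ) (seq-𝟏 m)) null-0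

    X≡ : ∀ m → X m ≡ p m * p m * (a * - 2ℚ + b * 2ℚ) + (p m * q′ m + q′ m * p m) * - 2ℚ + q′ m * q′ m * 2ℚ
    X≡ m = trans (seq-dot eigenvector eigenvector m) (dot-lin-g (p m) (q′ m) (p m) (q′ m))

    -- Here `i` stands for `1 / c`, so `c * i` is the desired norm 1. The right side separates the
    -- two sources of error: `w * w` against `1 / c`, and `E`.
    norm-identity : ∀ a b σ w i →
      let r = ½ * (a + σ)
          s = ½ * (a + - 1ℚ * σ)
          q′ = - 1ℚ * w * r
          c = σ * (2ℚ + a + σ)
      in (w * w * (a * - 2ℚ + b * 2ℚ) + (w * q′ + q′ * w) * - 2ℚ + q′ * q′ * 2ℚ) - c * i ≡
         c * (w * w - i) + 2ℚ * w * w * (b + r * s)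
    norm-identity = solve 5 (λ a b σ w i →
      let r = con ½ :* (a :+ σ)
          s = con ½ :* (a :+ con (- 1ℚ) :* σ)
          q′ = con (- 1ℚ) :* w :* r
          c = σ :* (con 2ℚ :+ a :+ σ)
      in (w :* w :* (a :* con (- 2ℚ) :+ b :* con 2ℚ) :+ (w :* q′ :+ q′ :* w) :* con (- 2ℚ) :+ q′ :* q′ :* con 2ℚ) :- c :* i :=
         c :* (w :* w :- i) :+ con 2ℚ :* w :* w :* (b :+ r :* s)) refl

    normalised : ⟨ eigenvector , eigenvector ⟩ ≈ᴿ 1ᴿ
    normalised = null-resp
      (λ m → trans (cong₂ _-_ (X≡ m) (sym (x*inv≡1 m))) (norm-identity a b (seq σ m) (seq w m) (inv (seq c m))))
      (null-+ (null-* c null-w-error) (null-* (fromℚ 2ℚ *ᴿ w *ᴿ w) null-E))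

    -- For `u = w (A g - r g)` one has `A u = s u + w E g` and `⟨u,g⟩ = - w (2 + 2 r)`; the literal
    -- zeros are the sum of `u`.
    value-identity : ∀ a b σ w →
      let r = ½ * (a + σ)
          s = ½ * (a + - 1ℚ * σ)
          q′ = - 1ℚ * w * r
          X = w * w * (a * - 2ℚ + b * 2ℚ) + (w * q′ + q′ * w) * - 2ℚ + q′ * q′ * 2ℚ
      in (- 1ℚ * (w * (w * a + q′) * (a * - 2ℚ + b * 2ℚ) + (w * (w * b) + q′ * (w * a + q′)) * - 2ℚ + q′ * (w * b) * 2ℚ)
           + - 2ℚ * X + 2ℚ * 0ℚ * 0ℚ) - (- 2ℚ + - 1ℚ * s) ≡
         - 1ℚ * (s + 2ℚ) * (X - 1ℚ) + w * w * (2ℚ + 2ℚ * r) * (b + r * s)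
    value-identity = solve 4 (λ a b σ w →
      let r = con ½ :* (a :+ σ)
          s = con ½ :* (a :+ con (- 1ℚ) :* σ)
          q′ = con (- 1ℚ) :* w :* r
          X = w :* w :* (a :* con (- 2ℚ) :+ b :* con 2ℚ) :+ (w :* q′ :+ q′ :* w) :* con (- 2ℚ) :+ q′ :* q′ :* con 2ℚ
      in (con (- 1ℚ) :* (w :* (w :* a :+ q′) :* (a :* con (- 2ℚ) :+ b :* con 2ℚ) :+ (w :* (w :* b) :+ q′ :* (w :* a :+ q′)) :* con (- 2ℚ) :+ q′ :* (w :* b) :* con 2ℚ)
           :+ con (- 2ℚ) :* X :+ con 2ℚ :* con 0ℚ :* con 0ℚ) :- (con (- 2ℚ) :+ con (- 1ℚ) :* s) :=
         con (- 1ℚ) :* (s :+ con 2ℚ) :* (X :- con 1ℚ) :+ w :* w :* (con 2ℚ :+ con 2ℚ :* r) :* (b :+ r :* s)) refl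

    d≡ : ∀ m → d m ≡ - 1ℚ * (p m * (p m * a + q′ m) * (a * - 2ℚ + b * 2ℚ)
        + (p m * (p m * b) + q′ m * (p m * a + q′ m)) * - 2ℚ + q′ m * (p m * b) * 2ℚ)
      + - 2ℚ * (p m * p m * (a * - 2ℚ + b * 2ℚ) + (p m * q′ m + q′ m * p m) * - 2ℚ + q′ m * q′ m * 2ℚ)
      + 2ℚ * 0ℚ * 0ℚ
    d≡ m = trans (seq-form eigenvector m) (cong₂ _+_
      (cong₂ (λ α β → - 1ℚ * α + - 2ℚ * β) (dot-f-Af (p m) (q′ m)) (dot-lin-g (p m) (q′ m) (p m) (q′ m)))
      (cong (λ t → 2ℚ * t * t) (sum-f (p m) (q′ m))))

    value : ⟨ eigenvector , D · eigenvector ⟩ ≈ᴿ q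
    value = null-resp
      (λ m → trans (cong (_- seq q m) (d≡ m))
        (trans (value-identity a b (seq σ m) (seq w m))
          (cong (λ t → - 1ℚ * (seq s m + 2ℚ) * (t - 1ℚ) + seq w m * seq w m * (2ℚ + 2ℚ * seq r m) * E m) (sym (X≡ m)))))
      (null-+ (null-* (fromℚ (- 1ℚ) *ᴿ (s +ᴿ fromℚ 2ℚ)) normalised)
        (null-* (w *ᴿ w *ᴿ (fromℚ 2ℚ +ᴿ fromℚ 2ℚ *ᴿ r)) null-E))

  -- The sign of the constant and the parameter condition.

  j : ℤ.ℤ
  j = ℤ.+ k ℤ.- ℤ.+ 2 ℤ.* ℤ.+ l ℤ.+ ℤ.+ μ

  ι-j : ι j ≡ K - 2ℚ * L + M
  ι-j = trans (ι-+ (ℤ.+ k ℤ.- ℤ.+ 2 ℤ.* ℤ.+ l) (ℤ.+ μ)) (cong (_+ M)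
    (trans (ι-+ (ℤ.+ k) (ℤ.- (ℤ.+ 2 ℤ.* ℤ.+ l))) (cong (K +_)
      (trans (ι-neg (ℤ.+ 2 ℤ.* ℤ.+ l)) (cong -_ (ι-* (ℤ.+ 2) (ℤ.+ l)))))))

  T t : ℚ
  T = 4ℚ + a
  t = 4ℚ - ι j

  t≡ : t ≡ 4ℚ + 2ℚ * a - b
  t≡ = trans (cong (λ u → 4ℚ - u) ι-j)
    (solve 3 (λ K L M → con 4ℚ :- (K :- con 2ℚ :* L :+ M) := con 4ℚ :+ con 2ℚ :* (L :- M) :- (K :- M)) refl K L M)

  -- The difference `T - t` is `b - a`. Once `T` is nonnegative, `σ + T` is at least 1 and can be
  -- cancelled.
  0≤t⇒0≤T : 0ℚ ≤ t → 0ℚ ≤ T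
  0≤t⇒0≤T 0≤t = ℚₚ.≤-trans 0≤t (≤-from-diff (b - a) (ℚₚ.≤-trans (ℚₚ.<⇒≤ 0<1) b-a≥1)
    (trans (solve 3 (λ f a b → f :+ a := (f :+ con 2ℚ :* a :- b) :+ (b :- a)) refl 4ℚ a b)
      (cong (_+ (b - a)) (sym t≡))))

  1≤σ+T : 0ℚ ≤ T → ∀ m → 1ℚ ≤ seq σ m + T
  1≤σ+T 0≤T m = ℚₚ.≤-trans (1≤σ m) (≤-from-diff T 0≤T refl)

  -- As `q` is half of `σ - T`, the product is half of `σ² - T²`. Here `Δ - T²` equals `- 4 t`, and
  -- the error of `σ²` against `Δ` becomes the term in `E`.
  q-identity : ∀ m → seq q m * (seq σ m + T) ≡ - 2ℚ * t + - 2ℚ * E m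
  q-identity m = trans
    (solve 3 (λ a b σ → (con (- 2ℚ) :+ con (- 1ℚ) :* (con ½ :* (a :+ con (- 1ℚ) :* σ))) :* (σ :+ (con 4ℚ :+ a)) :=
      con (- 2ℚ) :* (con 4ℚ :+ con 2ℚ :* a :- b) :+ con (- 2ℚ) :* (b :+ con ½ :* (a :+ σ) :* (con ½ :* (a :+ con (- 1ℚ) :* σ)))) refl a b (seq σ m))
    (cong (λ u → - 2ℚ * u + - 2ℚ * E m) (sym t≡))

  null-2E : Null (λ m → - 2ℚ * E m)
  null-2E = null-* (fromℚ (- 2ℚ)) null-E

  -2t≤0⇒0≤t : - 2ℚ * t ≤ 0ℚ → 0ℚ ≤ t
  -2t≤0⇒0≤t p = ℚₚ.*-cancelˡ-≤-neg (- 2ℚ) p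

  -- If `T` is nonnegative, multiplying `q` by the positive factor `σ + T` leaves `- 2 t` at most 0
  -- in the limit. If `T` is nonpositive, `q` is at least `½` at every index, contrary to the
  -- hypothesis.
  limNonPos⇒0≤t : LimNonPos (seq q) → 0ℚ ≤ t
  limNonPos⇒0≤t q≤0 = [ T-nonNeg , T-nonPos ]′ (ℚₚ.≤-total 0ℚ T)
    where
    ½≤q : T ≤ 0ℚ → ∀ m → ½ ≤ seq q m
    ½≤q T≤0 m = ≤-from-diff (½ * ((seq σ m - 1ℚ) + (0ℚ - T)))
      (*-nonNeg (ℚₚ.nonNegative⁻¹ ½) (+-nonNeg (≤⇒0≤- (1≤σ m)) (≤⇒0≤- T≤0)))
      (solve 2 (λ a σ → con (- 2ℚ) :+ con (- 1ℚ) :* (con ½ :* (a :+ con (- 1ℚ) :* σ)) :=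
        con ½ :+ con ½ :* ((σ :- con 1ℚ) :+ (con 0ℚ :- (con 4ℚ :+ a)))) refl a (seq σ m))

    T-nonPos : T ≤ 0ℚ → 0ℚ ≤ t
    T-nonPos T≤0 = ⊥-elim (ℚₚ.<-irrefl refl (ℚₚ.<-≤-trans (ℚₚ.positive⁻¹ ½)
      (limNonPos-const (limNonPos-dominated (½≤q T≤0) q≤0))))

    -2t≡ : ∀ m → - 2ℚ * t ≡ seq q m * (seq σ m + T) + - 1ℚ * (- 2ℚ * E m)
    -2t≡ m = trans
      (solve 2 (λ u v → u := u :+ v :+ con (- 1ℚ) :* v) refl (- 2ℚ * t) (- 2ℚ * E m))
      (cong (_+ - 1ℚ * (- 2ℚ * E m)) (sym (q-identity m)))

    T-nonNeg : 0ℚ ≤ T → 0ℚ ≤ t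
    T-nonNeg 0≤T = -2t≤0⇒0≤t (limNonPos-const (limNonPos-dominated
      (λ m → ℚₚ.≤-reflexive (-2t≡ m))
      (limNonPos-+null
        (limNonPos-* (σ +ᴿ fromℚ T) (λ m → ℚₚ.≤-trans (ℚₚ.<⇒≤ 0<1) (1≤σ+T 0≤T m)) q≤0)
        (null-* (fromℚ (- 1ℚ)) null-2E))))

  0≤t⇒limNonPos : 0ℚ ≤ t → LimNonPos (seq q)
  0≤t⇒limNonPos 0≤t = limNonPos-cancel (1≤σ+T (0≤t⇒0≤T 0≤t))
    (limNonPos-dominated (λ m → ≤-from-diff (2ℚ * t) (*-nonNeg (0≤ι 2) 0≤t)
        (trans (solve 2 (λ u v → v := con (- 2ℚ) :* u :+ v :+ con 2ℚ :* u) refl t (- 2ℚ * E m))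
          (cong (_+ 2ℚ * t) (sym (q-identity m)))))
      (null⇒limNonPos null-2E))

  -- Multiplication by a convergent sequence preserves null sequences whatever the sign of `σ + T`,
  -- so `T` needs no case distinction.
  null⇒t≡0 : Null (seq q) → t ≡ 0ℚ
  null⇒t≡0 null-q = begin
    t                    ≡⟨ solve 1 (λ t → t := con (- ½) :* (con (- 2ℚ) :* t)) refl t ⟩
    - ½ * (- 2ℚ * t)     ≡⟨ cong (- ½ *_) (null-const (null-+⁻ {λ _ → - 2ℚ * t} sum-null null-2E)) ⟩
    - ½ * 0ℚ             ≡⟨ ℚₚ.*-zeroʳ (- ½) ⟩
    0ℚ                   ∎
    where
    open ≡-Reasoning
    sum-null : Null (λ m → - 2ℚ * t + - 2ℚ * E m)
    sum-null = null-resp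
      (λ m → trans (sym (q-identity m)) (ℚₚ.*-comm (seq q m) (seq σ m + T)))
      (null-* (σ +ᴿ fromℚ T) null-q)

  t≡0⇒null : t ≡ 0ℚ → Null (seq q)
  t≡0⇒null t≡0 = null-cancel (1≤σ+T (0≤t⇒0≤T (ℚₚ.≤-reflexive (sym t≡0))))
    (null-resp (λ m → trans (q-identity m) (trans (cong (λ u → - 2ℚ * u + - 2ℚ * E m) t≡0)
      (solve 1 (λ v → con (- 2ℚ) :* con 0ℚ :+ v := v) refl (- 2ℚ * E m)))) null-2E)

  0≤t⇒j≤4 : 0ℚ ≤ t → j ℤ.≤ ℤ.+ 4
  0≤t⇒j≤4 0≤t = ι-cancel-≤ {j} {ℤ.+ 4} (≤-from-diff t 0≤t (solve 2 (λ f u → f := u :+ (f :- u)) refl 4ℚ (ι j)))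

  j≤4⇒0≤t : j ℤ.≤ ℤ.+ 4 → 0ℚ ≤ t
  j≤4⇒0≤t j≤4 = ≤⇒0≤- (ι-mono-≤ {j} {ℤ.+ 4} j≤4)

  t≡0⇒j≡4 : t ≡ 0ℚ → j ≡ ℤ.+ 4
  t≡0⇒j≡4 t≡0 = ℤₚ.≤-antisym
    (ι-cancel-≤ {j} {ℤ.+ 4} (ℚₚ.≤-reflexive ιj≡4))
    (ι-cancel-≤ {ℤ.+ 4} {j} (ℚₚ.≤-reflexive (sym ιj≡4)))
    where
    ιj≡4 : ι j ≡ 4ℚ
    ιj≡4 = trans (solve 2 (λ f u → u := f :- (f :- u)) refl 4ℚ (ι j)) (cong (λ u → 4ℚ - u) t≡0)

  j≡4⇒t≡0 : j ≡ ℤ.+ 4 → t ≡ 0ℚ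
  j≡4⇒t≡0 j≡4 = trans (cong (λ i → 4ℚ - ι i) j≡4) (ℚₚ.+-inverseʳ 4ℚ)

  q≤0⇒j≤4 : q ≤ᴿ 0ᴿ → j ℤ.≤ ℤ.+ 4
  q≤0⇒j≤4 q≤0 = 0≤t⇒j≤4 (limNonPos⇒0≤t λ {ε} 0<ε →
    proj₁ (q≤0 0<ε) , λ {m} p → subst (seq q m <_) (ℚₚ.+-identityˡ ε) (proj₂ (q≤0 0<ε) p))

  j≤4⇒q≤0 : j ℤ.≤ ℤ.+ 4 → q ≤ᴿ 0ᴿ
  j≤4⇒q≤0 j≤4 {ε} 0<ε = proj₁ (lim 0<ε) , λ {m} p →
    subst (seq q m <_) (sym (ℚₚ.+-identityˡ ε)) (proj₂ (lim 0<ε) p)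
    where
    lim : LimNonPos (seq q)
    lim = 0≤t⇒limNonPos (j≤4⇒0≤t j≤4)

  q≈0⇒j≡4 : q ≈ᴿ 0ᴿ → j ≡ ℤ.+ 4
  q≈0⇒j≡4 q≈0 = t≡0⇒j≡4 (null⇒t≡0 (null-resp (λ m → sym (ℚₚ.+-identityʳ (seq q m))) q≈0))

  j≡4⇒q≈0 : j ≡ ℤ.+ 4 → q ≈ᴿ 0ᴿ
  j≡4⇒q≈0 j≡4 = null-resp (λ m → ℚₚ.+-identityʳ (seq q m)) (t≡0⇒null (j≡4⇒t≡0 j≡4))

  -- This is `IsQEC` for an abstract matrix; at the distance matrix both unfold to the same type.
  IsMaximum : ℝ → Set
  IsMaximum q =
    (∃ λ f → (⟨ f , f ⟩ ≈ᴿ 1ᴿ × ⟨ 𝟏 , f ⟩ ≈ᴿ 0ᴿ) × ⟨ f , D · f ⟩ ≈ᴿ q) ×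
    (∀ f → ⟨ f , f ⟩ ≈ᴿ 1ᴿ × ⟨ 𝟏 , f ⟩ ≈ᴿ 0ᴿ → ⟨ f , D · f ⟩ ≤ᴿ q)

  q-isMaximum : IsMaximum q
  q-isMaximum = (eigenvector , (normalised , orthogonal) , value) , upper
    where open Eigenvector

  maximum-sign : ∃ λ q → IsMaximum q × (q ≤ᴿ 0ᴿ ⇔ j ℤ.≤ ℤ.+ 4) × (q ≈ᴿ 0ᴿ ⇔ j ≡ ℤ.+ 4)
  maximum-sign = q , q-isMaximum , mk⇔ q≤0⇒j≤4 j≤4⇒q≤0 , mk⇔ q≈0⇒j≡4 j≡4⇒q≈0

-- Specialisation to the distance matrix.

open import Data.Integer.Base using (+_; _+_; _-_; _*_; _≤_)

theorem1p2 : ∀ {n k l μ : ℕ} (G : Graph n) (srg : IsStronglyRegular G k l μ) (1≤μ : 1 ℕ.≤ μ) → Graph.NonComplete G →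
    ∃ λ q → IsQEC G (srg-connected srg 1≤μ) q
    × (q ≤ᴿ 0ᴿ ⇔ + k - + 2 * + l + + μ ≤ + 4)
    × (q ≈ᴿ 0ᴿ ⇔ + k - + 2 * + l + + μ ≡ + 4)
theorem1p2 G srg 1≤μ (x , y , x≢y , x≁y) =
  QuadraticEmbedding.maximum-sign G srg 1≤μ x≢y x≁y x~z (distanceMatrix G (srg-connected srg 1≤μ)) (D-entry G srg 1≤μ)
  where
  open StronglyRegular using (D-entry; commonNeighbour)
  -- A common neighbour of the given non-adjacent pair supplies the edge on which the eigenvector is
  -- built.
  x~z = proj₁ (proj₂ (commonNeighbour G srg 1≤μ x≢y x≁y))
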